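{- Let $(Q_{i,j,k})_{(i,j,k)\in\mathbb{Z}^3}$ be a generic $3$-dimensional $Q$-net, with associated variables $Y^{*}_{i,j,k}$ and $\tilde Y^{*}_{i,j,k}$ ($*\in\{x,y,z\}$). Then for every $t\in\mathbb{Z}$ and all $i,j,k$ with $i+j+k=t$, $$\tilde{Y}_{i,j+1,k+1}^x=(Y_{i,j,k}^y)^{ -1}\,\frac{1+Y_{i,j,k}^x+Y_{i,j,k}^yY_{i,j,k}^x}{1+Y_{i,j,k}^z+Y_{i,j,k}^zY_{i,j,k}^x},$$ $$Y_{i+1,j,k}^x=\tilde{Y}_{i+1,j,k}^x\,Y_{i+1,j-1,k}^x\,Y_{i+1,j-1,k}^y\,\frac{1+Y_{i+1,j,k-1}^z+Y_{i+1,j,k-1}^zY_{i+1,j,k-1}^x}{1+Y_{i+1,j-1,k}^x+Y_{i+1,j-1,k}^xY_{i+1,j-1,k}^y},$$ together with the cyclic shifts of these formulas, namely $$\tilde{Y}_{i+1,j,k+1}^y=(Y_{i,j,k}^z)^{ -1}\,\frac{1+Y_{i,j,k}^y+Y_{i,j,k}^zY_{i,j,k}^y}{1+Y_{i,j,k}^x+Y_{i,j,k}^xY_{i,j,k}^y},\qquad \tilde{Y}_{i+1,j+1,k}^z=(Y_{i,j,k}^x)^{ -1}\,\frac{1+Y_{i,j,k}^z+Y_{i,j,k}^xY_{i,j,k}^z}{1+Y_{i,j,k}^y+Y_{i,j,k}^yY_{i,j,k}^z},$$ $$Y_{i,j+1,k}^y=\tilde{Y}_{i,j+1,k}^y\,Y_{i,j+1,k-1}^y\,Y_{i,j+1,k-1}^z\,\frac{1+Y_{i-1,j+1,k}^x+Y_{i-1,j+1,k}^xY_{i-1,j+1,k}^y}{1+Y_{i,j+1,k-1}^y+Y_{i,j+1,k-1}^yY_{i,j+1,k-1}^z},$$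 $$Y_{i,j,k+1}^z=\tilde{Y}_{i,j,k+1}^z\,Y_{i-1,j,k+1}^z\,Y_{i-1,j,k+1}^x\,\frac{1+Y_{i,j-1,k+1}^y+Y_{i,j-1,k+1}^yY_{i,j-1,k+1}^z}{1+Y_{i-1,j,k+1}^z+Y_{i-1,j,k+1}^zY_{i-1,j,k+1}^x}.$$
   Context: A $3$-dimensional $Q$-net is a map $\mathbb{Z}^3\to\mathbb{R}^3$ (viewed in projective space), $(i,j,k)\mapsto Q_{i,j,k}$, such that for every unit square $u,u+e_a,u+e_b,u+e_a+e_b$ of $\mathbb{Z}^3$ the four corresponding points are coplanar. Generic means: the four points of each unit square have no three collinear; for each elementary cube with minimal corner $u$, the points at $u,u+e_1,u+e_2,u+e_3$ are not coplanar, and the planes spanned by the three faces at $u+e_1+e_2+e_3$ meet in exactly one point; and all quantities and fractions below are defined (with nonzero denominators). $Q^x_{i,j,k}$ is the line through $Q_{i,j,k}$ and $Q_{i+1,j,k}$; $Q^y_{i,j,k}$ the line through $Q_{i,j,k}$ and $Q_{i,j+1,k}$; $Q^z_{i,j,k}$ the line through $Q_{i,j,k}$ and $Q_{i,j,k+1}$. For collinear points in an affine chart, $[P_1,P_2,P_3,P_4]=\frac{P_1-P_2}{P_2-P_3}\cdot\frac{P_3-P_4}{P_4-P_1}$ (projectively invariant). Define $$Y^x_{i,j,k}=-[Q_{i,j,k},\,Q^x_{i,j,k}\cap Q^x_{i,j+1,k},\,Q_{i+1,j,k},\,Q^x_{i,j,k}\cap Q^x_{i,j,k+1}]^{ -1},$$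 $$Y^y_{i,j,k}=-[Q_{i,j,k},\,Q^y_{i,j,k}\cap Q^y_{i,j,k+1},\,Q_{i,j+1,k},\,Q^y_{i,j,k}\cap Q^y_{i+1,j,k}]^{ -1},$$ $$Y^z_{i,j,k}=-[Q_{i,j,k},\,Q^z_{i,j,k}\cap Q^z_{i+1,j,k},\,Q_{i,j,k+1},\,Q^z_{i,j,k}\cap Q^z_{i,j+1,k}]^{ -1},$$ $$\tilde Y^x_{i,j,k}=-[Q_{i,j,k},\,Q^x_{i,j,k}\cap Q^x_{i,j,k-1},\,Q_{i+1,j,k},\,Q^x_{i,j,k}\cap Q^x_{i,j-1,k}]^{ -1},$$ $$\tilde Y^y_{i,j,k}=-[Q_{i,j,k},\,Q^y_{i,j,k}\cap Q^y_{i-1,j,k},\,Q_{i,j+1,k},\,Q^y_{i,j,k}\cap Q^y_{i,j,k-1}]^{ -1},$$ $$\tilde Y^z_{i,j,k}=-[Q_{i,j,k},\,Q^z_{i,j,k}\cap Q^z_{i,j-1,k},\,Q_{i,j,k+1},\,Q^z_{i,j,k}\cap Q^z_{i-1,j,k}]^{ -1}.$$ The variables $\{Y^*_{i,j,k}:i+j+k=t\}\cup\{\tilde Y^*_{i,j,k}:i+j+k=t+1\}$ are the face weights at time $t$; the formulas express those at time $t+1$ in terms of those at time $t$. -}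

module Defs where

open import Level using (0ℓ)
open import Data.Nat.Base as ℕ using (ℕ)
import Data.Nat.Properties as ℕ
open import Data.Rational.Base as ℚ using (ℚ; 0ℚ; 1ℚ; ½; ∣_∣)
import Data.Rational.Properties as ℚ
open import Data.Rational.Solver using (module +-*-Solver)
open import Data.Integer.Base using (ℤ; 1ℤ) renaming (_+_ to _+ᶻ_; _-_ to _-ᶻ_)
open import Data.Fin.Base using (Fin)
open import Data.Fin.Patterns using (0F; 1F; 2F)
open import Data.Vec.Functional using (Vector; []; _∷_)
open import Data.Product using (Σ-syntax; ∃; ∃-syntax; _×_; _,_; proj₁)
open import Data.Sum.Base using (_⊎_; inj₁; inj₂)
open import Data.Empty using (⊥; ⊥-elim)
open import Relation.Nullary using (¬_; Dec; yes; no)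
open import Relation.Unary using (Pred; _∈_; _∩_)
open import Relation.Binary.PropositionalEquality
  using (_≡_; _≢_; refl; sym; trans; cong; cong₂; subst; subst₂)
open import Relation.Binary.Structures using (IsEquivalence; IsApartnessRelation)
open import Algebra.Structures using (IsCommutativeRing)
open import Algebra.Bundles using (CommutativeRing)
open import Algebra.Apartness.Bundles using (HeytingField; HeytingCommutativeRing)
open import Algebra.Apartness.Structures using (IsHeytingField)
import Algebra.Properties.CommutativeMonoid.Sum as Sum
import Data.Vec.Functional.Relation.Binary.Equality.Setoid as Equality

module Bounds where
  open import Data.Rational.Base
  open import Data.Rational.Properties


  abstract
    <⇒≱ : ∀ {p q} → p < q → ¬ q ≤ p
    <⇒≱ p<q q≤p = <-irrefl refl (<-≤-trans p<q q≤p)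

    halve : ∀ {ε} → 0ℚ < ε → ∃[ δ ] 0ℚ < δ × δ + δ ≡ ε
    halve {ε} 0<ε = ½ * ε , 0<½ε , solve 1 (λ e → con ½ :* e :+ con ½ :* e := e) refl ε
      where
      open +-*-Solver
      0<½ε : 0ℚ < ½ * ε
      0<½ε = subst (_< ½ * ε) (*-zeroʳ ½) (*-monoʳ-<-pos ½ 0<ε)

    quotient : ∀ {ε B} → 0ℚ < ε → 0ℚ < B → ∃[ δ ] 0ℚ < δ × B * δ ≡ ε
    quotient {ε} {B} 0<ε 0<B = δ , 0<δ , Bδ≡ε
      where
      instance
        posB : Positive B
        posB = positive 0<B
        B≢0 : NonZero B
        B≢0 = pos⇒nonZero B
        posB⁻¹ : Positive (1/ B)
        posB⁻¹ = 1/pos⇒pos B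
      δ : ℚ
      δ = 1/ B * ε
      0<δ : 0ℚ < δ
      0<δ = subst (_< δ) (*-zeroʳ (1/ B)) (*-monoʳ-<-pos (1/ B) 0<ε)
      Bδ≡ε : B * δ ≡ ε
      Bδ≡ε = trans (sym (*-assoc B (1/ B) ε)) (trans (cong (_* ε) (*-inverseʳ B)) (*-identityˡ ε))

    ∣*∣≤ : ∀ {p q B C} → ∣ p ∣ ≤ B → ∣ q ∣ ≤ C → ∣ p * q ∣ ≤ B * C
    ∣*∣≤ {p} {q} {B} {C} p≤B q≤C = begin
      ∣ p * q ∣      ≡⟨ ∣p*q∣≡∣p∣*∣q∣ p q ⟩
      ∣ p ∣ * ∣ q ∣  ≤⟨ *-monoˡ-≤-nonNeg ∣ p ∣ {{∣-∣-nonNeg p}} q≤C ⟩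
      ∣ p ∣ * C      ≤⟨ *-monoʳ-≤-nonNeg C {{nonNegative (≤-trans (0≤∣p∣ q) q≤C)}} p≤B ⟩
      B * C          ∎
      where open ≤-Reasoning

    ∣p-q∣≡∣q-p∣ : ∀ p q → ∣ p - q ∣ ≡ ∣ q - p ∣
    ∣p-q∣≡∣q-p∣ p q = trans (cong ∣_∣ (solve 2 (λ a b → a :- b := :- (b :- a)) refl p q)) (∣-p∣≡∣p∣ (q - p))
      where open +-*-Solver

    ∣p-r∣≤ : ∀ p q r → ∣ p - r ∣ ≤ ∣ p - q ∣ + ∣ q - r ∣
    ∣p-r∣≤ p q r = subst (_≤ ∣ p - q ∣ + ∣ q - r ∣)
      (cong ∣_∣ (solve 3 (λ a b c → (a :- b) :+ (b :- c) := a :- c) refl p q r))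
      (∣p+q∣≤∣p∣+∣q∣ (p - q) (q - r))
      where open +-*-Solver

    -- If p′ and q′ are within δ of p and q, their distance shrinks by at most 2δ.
    perturb : ∀ {δ ε} p q p′ q′ → ∣ p - p′ ∣ ≤ δ → ∣ q′ - q ∣ ≤ δ →
              (δ + δ) + ε ≤ ∣ p - q ∣ → ε ≤ ∣ p′ - q′ ∣
    perturb {δ} {ε} p q p′ q′ pp′ q′q far = ≮⇒≥ λ near → <⇒≱ (begin-strict
      ∣ p - q ∣                                  ≤⟨ ∣p-r∣≤ p p′ q ⟩
      ∣ p - p′ ∣ + ∣ p′ - q ∣                    ≤⟨ +-monoʳ-≤ ∣ p - p′ ∣ (∣p-r∣≤ p′ q′ q) ⟩
      ∣ p - p′ ∣ + (∣ p′ - q′ ∣ + ∣ q′ - q ∣)    ≤⟨ +-mono-≤ pp′ (+-monoʳ-≤ ∣ p′ - q′ ∣ q′q) ⟩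
      δ + (∣ p′ - q′ ∣ + δ)                      ≡⟨ solve 2 (λ d e → d :+ (e :+ d) := (d :+ d) :+ e) refl δ ∣ p′ - q′ ∣ ⟩
      (δ + δ) + ∣ p′ - q′ ∣                      <⟨ +-monoʳ-< (δ + δ) near ⟩
      (δ + δ) + ε                                ∎) far
      where
      open +-*-Solver
      open ≤-Reasoning

    -- 1/q, with the junk value 0 at q = 0.
    recip : ℚ → ℚ
    recip q with q ≟ 0ℚ
    ... | yes _  = 0ℚ
    ... | no q≢0 = (1/ q) {{≢-nonZero q≢0}}

    recip-inverse : ∀ {ε} q → 0ℚ < ε → ε ≤ ∣ q ∣ → q * recip q ≡ 1ℚ
    recip-inverse q 0<ε ε≤q with q ≟ 0ℚ
    ... | yes refl = ⊥-elim (<⇒≱ 0<ε ε≤q)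
    ... | no q≢0   = *-inverseʳ q {{≢-nonZero q≢0}}

    -- If p q = 1 and ε ≤ |p| then |q| ≤ δ, for δ the inverse of ε.
    cofactor : ∀ {ε δ} p q → 0ℚ < ε → ε ≤ ∣ p ∣ → p * q ≡ 1ℚ → ε * δ ≡ 1ℚ → ∣ q ∣ ≤ δ
    cofactor {ε} {δ} p q 0<ε ε≤p pq≡1 εδ≡1 = *-cancelˡ-≤-pos ε {{positive 0<ε}} (begin
      ε * ∣ q ∣      ≤⟨ *-monoʳ-≤-nonNeg ∣ q ∣ {{∣-∣-nonNeg q}} ε≤p ⟩
      ∣ p ∣ * ∣ q ∣  ≡⟨ ∣p*q∣≡∣p∣*∣q∣ p q ⟨
      ∣ p * q ∣      ≡⟨ cong ∣_∣ pq≡1 ⟩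
      1ℚ             ≡⟨ εδ≡1 ⟨
      ε * δ          ∎)
      where open ≤-Reasoning

-- Real numbers are Cauchy sequences of rationals; two of them are equal when
-- their difference tends to 0, and apart when their distance is eventually
-- bounded away from 0.

record ℝ : Set where
  constructor mkℝ
  field
    seq    : ℕ → ℚ
    cauchy : ∀ ε → 0ℚ ℚ.< ε → ∃[ N ] ∀ m n → N ℕ.≤ m → N ℕ.≤ n → ∣ seq m ℚ.- seq n ∣ ℚ.≤ ε

open ℝ using (seq; cauchy)

infix 4 _≈ʳ_ _#ʳ_

record _≈ʳ_ (x y : ℝ) : Set where
  constructor mk≈
  field
    close : ∀ ε → 0ℚ ℚ.< ε → ∃[ N ] ∀ n → N ℕ.≤ n → ∣ seq x n ℚ.- seq y n ∣ ℚ.≤ ε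

record _#ʳ_ (x y : ℝ) : Set where
  constructor mk#
  field
    gap      : ℚ
    0<gap    : 0ℚ ℚ.< gap
    from     : ℕ
    distance : ∀ n → from ℕ.≤ n → gap ℚ.≤ ∣ seq x n ℚ.- seq y n ∣

-- Null and eventually bounded families indexed by a type with a notion of being
-- late, to treat sequences and doubly indexed families uniformly.
module Families (I : Set) (Late : ℕ → I → Set)
                (late-mono : ∀ {M N i} → M ℕ.≤ N → Late N i → Late M i) where
  open import Data.Rational.Base
  open import Data.Rational.Properties
  open Bounds

  Null : (I → ℚ) → Set
  Null f = ∀ ε → 0ℚ < ε → ∃[ N ] ∀ i → Late N i → ∣ f i ∣ ≤ ε

  Bounded : (I → ℚ) → Set
  Bounded f = ∃[ B ] 0ℚ < B × (∃[ N ] ∀ i → Late N i → ∣ f i ∣ ≤ B)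

  late₁ : ∀ {M N i} → Late (M ℕ.⊔ N) i → Late M i
  late₁ {M} {N} = late-mono (ℕ.m≤m⊔n M N)

  late₂ : ∀ {M N i} → Late (M ℕ.⊔ N) i → Late N i
  late₂ {M} {N} = late-mono (ℕ.m≤n⊔m M N)

  null-cong : ∀ {f g} N → (∀ i → Late N i → f i ≡ g i) → Null f → Null g
  null-cong N f≡g f-null ε 0<ε = let M , f≤ε = f-null ε 0<ε in
    M ℕ.⊔ N , λ i late → subst (λ q → ∣ q ∣ ≤ ε) (f≡g i (late₂ late)) (f≤ε i (late₁ late))

  null-zero : ∀ {f} → (∀ i → f i ≡ 0ℚ) → Null f
  null-zero f≡0 ε 0<ε = 0 , λ i _ → subst (λ q → ∣ q ∣ ≤ ε) (sym (f≡0 i)) (<⇒≤ 0<ε)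

  null-+ : ∀ {f g} → Null f → Null g → Null (λ i → f i + g i)
  null-+ {f} {g} f-null g-null ε 0<ε with halve 0<ε
  ... | δ , 0<δ , δ+δ≡ε = let M , f≤δ = f-null δ 0<δ; N , g≤δ = g-null δ 0<δ in
    M ℕ.⊔ N , λ i late → begin
      ∣ f i + g i ∣      ≤⟨ ∣p+q∣≤∣p∣+∣q∣ (f i) (g i) ⟩
      ∣ f i ∣ + ∣ g i ∣  ≤⟨ +-mono-≤ (f≤δ i (late₁ late)) (g≤δ i (late₂ late)) ⟩
      δ + δ              ≡⟨ δ+δ≡ε ⟩
      ε                  ∎
    where open ≤-Reasoning

  null-neg : ∀ {f} → Null f → Null (λ i → - f i)
  null-neg {f} f-null ε 0<ε = let N , f≤ε = f-null ε 0<ε in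
    N , λ i late → subst (_≤ ε) (sym (∣-p∣≡∣p∣ (f i))) (f≤ε i late)

  null-* : ∀ {f g} → Bounded f → Null g → Null (λ i → f i * g i)
  null-* {f} {g} (B , 0<B , M , f≤B) g-null ε 0<ε with quotient 0<ε 0<B
  ... | δ , 0<δ , refl = let N , g≤δ = g-null δ 0<δ in
    M ℕ.⊔ N , λ i late → ∣*∣≤ {f i} {g i} (f≤B i (late₁ late)) (g≤δ i (late₂ late))

  bounded-* : ∀ {f g} → Bounded f → Bounded g → Bounded (λ i → f i * g i)
  bounded-* {f} {g} (B , 0<B , M , f≤B) (C , 0<C , N , g≤C) =
    B * C ,
    subst (_< B * C) (*-zeroʳ B) (*-monoʳ-<-pos B {{positive 0<B}} 0<C) ,
    M ℕ.⊔ N , λ i late → ∣*∣≤ {f i} {g i} (f≤B i (late₁ late)) (g≤C i (late₂ late))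

module ℝ-Field where
  open import Data.Rational.Base
  open import Data.Rational.Properties hiding (≤-trans; isHeytingField)
  open Data.Rational.Properties using () renaming (≤-trans to ℚ-≤-trans)
  open Bounds
  open +-*-Solver using (solve; con; _:=_; _:+_; _:*_; _:-_; :-_)

  module Single = Families ℕ ℕ._≤_ ℕ.≤-trans
  module Double = Families (ℕ × ℕ) (λ N (m , n) → N ℕ.≤ m × N ℕ.≤ n)
                           (λ M≤N (N≤m , N≤n) → ℕ.≤-trans M≤N N≤m , ℕ.≤-trans M≤N N≤n)
  open Single using () renaming (Null to Null₁; Bounded to Bounded₁)
  open Double using () renaming (Null to Null₂; Bounded to Bounded₂)

  differences : (ℕ → ℚ) → ℕ × ℕ → ℚ
  differences s (m , n) = s m - s n

  null₂ : ∀ x → Null₂ (differences (seq x))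
  null₂ x ε 0<ε = let N , c = cauchy x ε 0<ε in N , λ (m , n) (N≤m , N≤n) → c m n N≤m N≤n

  real : (s : ℕ → ℚ) → Null₂ (differences s) → ℝ
  real s s-null = mkℝ s (λ ε 0<ε → let N , c = s-null ε 0<ε in N , λ m n N≤m N≤n → c (m , n) (N≤m , N≤n))

  null₁ : ∀ {x y} → x ≈ʳ y → Null₁ (λ n → seq x n - seq y n)
  null₁ = _≈ʳ_.close

  bounded₁ : ∀ x → Bounded₁ (seq x)
  bounded₁ x = let N , c = cauchy x 1ℚ 0<1 in
    ∣ seq x N ∣ + 1ℚ , +-mono-≤-< (0≤∣p∣ (seq x N)) 0<1 , N , λ n N≤n → begin
      ∣ seq x n ∣                        ≡⟨ cong ∣_∣ (solve 2 (λ a b → a := b :+ (a :- b)) refl (seq x n) (seq x N)) ⟩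
      ∣ seq x N + (seq x n - seq x N) ∣  ≤⟨ ∣p+q∣≤∣p∣+∣q∣ (seq x N) (seq x n - seq x N) ⟩
      ∣ seq x N ∣ + ∣ seq x n - seq x N ∣ ≤⟨ +-monoʳ-≤ ∣ seq x N ∣ (c n N N≤n ℕ.≤-refl) ⟩
      ∣ seq x N ∣ + 1ℚ                   ∎
    where
    open ≤-Reasoning
    0<1 : 0ℚ < 1ℚ
    0<1 = positive⁻¹ 1ℚ

  fst-bounded : ∀ {s} → Bounded₁ s → Bounded₂ (λ (m , n) → s m)
  fst-bounded (B , 0<B , N , s≤B) = B , 0<B , N , λ (m , n) (N≤m , _) → s≤B m N≤m

  snd-bounded : ∀ {s} → Bounded₁ s → Bounded₂ (λ (m , n) → s n)
  snd-bounded (B , 0<B , N , s≤B) = B , 0<B , N , λ (m , n) (_ , N≤n) → s≤B n N≤n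

  abstract
    constant-null : ∀ q → Null₂ (differences (λ _ → q))
    constant-null q = Double.null-zero (λ _ → +-inverseʳ q)

    +-null : ∀ x y → Null₂ (differences (λ n → seq x n + seq y n))
    +-null x y = Double.null-cong 0
      (λ (m , n) _ → solve 4 (λ a b c d → (a :- b) :+ (c :- d) := (a :+ c) :- (b :+ d)) refl
                       (seq x m) (seq x n) (seq y m) (seq y n))
      (Double.null-+ {differences (seq x)} {differences (seq y)} (null₂ x) (null₂ y))

    *-null : ∀ x y → Null₂ (differences (λ n → seq x n * seq y n))
    *-null x y = Double.null-cong 0
      (λ (m , n) _ → solve 4 (λ a b c d → a :* (c :- d) :+ d :* (a :- b) := a :* c :- b :* d) refl
                       (seq x m) (seq x n) (seq y m) (seq y n))
      (Double.null-+ {λ (m , n) → seq x m * (seq y m - seq y n)} {λ (m , n) → seq y n * (seq x m - seq x n)}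
        (Double.null-* {λ (m , n) → seq x m} {differences (seq y)} (fst-bounded (bounded₁ x)) (null₂ y))
        (Double.null-* {λ (m , n) → seq y n} {differences (seq x)} (snd-bounded (bounded₁ y)) (null₂ x)))

    neg-null : ∀ x → Null₂ (differences (λ n → - seq x n))
    neg-null x = Double.null-cong 0
      (λ (m , n) _ → solve 2 (λ a b → :- (a :- b) := (:- a) :- (:- b)) refl (seq x m) (seq x n))
      (Double.null-neg {differences (seq x)} (null₂ x))

  infixl 6 _+ʳ_
  infixl 7 _*ʳ_
  infix  8 -ʳ_

  constant : ℚ → ℝ
  constant q = real (λ _ → q) (constant-null q)

  _+ʳ_ _*ʳ_ : ℝ → ℝ → ℝ
  x +ʳ y = real (λ n → seq x n + seq y n) (+-null x y)
  x *ʳ y = real (λ n → seq x n * seq y n) (*-null x y)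

  -ʳ_ : ℝ → ℝ
  -ʳ x = real (λ n → - seq x n) (neg-null x)

  0ʳ 1ʳ : ℝ
  0ʳ = constant 0ℚ
  1ʳ = constant 1ℚ

  abstract
    pointwise : ∀ x y → (∀ n → seq x n ≡ seq y n) → x ≈ʳ y
    pointwise x y x≡y = mk≈ (Single.null-zero
      (λ n → trans (cong (_- seq y n) (x≡y n)) (+-inverseʳ (seq y n))))

    ≈-isEquivalence : IsEquivalence _≈ʳ_
    ≈-isEquivalence = record
      { refl  = λ {x} → pointwise x x (λ _ → refl)
      ; sym   = λ {x} {y} x≈y → mk≈ (Single.null-cong 0
          (λ n _ → solve 2 (λ a b → :- (a :- b) := b :- a) refl (seq x n) (seq y n))
          (Single.null-neg {λ n → seq x n - seq y n} (null₁ x≈y)))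
      ; trans = λ {x} {y} {z} x≈y y≈z → mk≈ (Single.null-cong 0
          (λ n _ → solve 3 (λ a b c → (a :- b) :+ (b :- c) := a :- c) refl (seq x n) (seq y n) (seq z n))
          (Single.null-+ {λ n → seq x n - seq y n} {λ n → seq y n - seq z n} (null₁ x≈y) (null₁ y≈z)))
      }

    +-congʳ′ : ∀ {x x′ y y′} → x ≈ʳ x′ → y ≈ʳ y′ → x +ʳ y ≈ʳ x′ +ʳ y′
    +-congʳ′ {x} {x′} {y} {y′} x≈x′ y≈y′ = mk≈ (Single.null-cong 0
      (λ n _ → solve 4 (λ a b c d → (a :- b) :+ (c :- d) := (a :+ c) :- (b :+ d)) refl
                 (seq x n) (seq x′ n) (seq y n) (seq y′ n))
      (Single.null-+ {λ n → seq x n - seq x′ n} {λ n → seq y n - seq y′ n} (null₁ x≈x′) (null₁ y≈y′)))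

    *-congʳ′ : ∀ {x x′ y y′} → x ≈ʳ x′ → y ≈ʳ y′ → x *ʳ y ≈ʳ x′ *ʳ y′
    *-congʳ′ {x} {x′} {y} {y′} x≈x′ y≈y′ = mk≈ (Single.null-cong 0
      (λ n _ → solve 4 (λ a b c d → a :* (c :- d) :+ d :* (a :- b) := a :* c :- b :* d) refl
                 (seq x n) (seq x′ n) (seq y n) (seq y′ n))
      (Single.null-+ {λ n → seq x n * (seq y n - seq y′ n)} {λ n → seq y′ n * (seq x n - seq x′ n)}
        (Single.null-* {seq x} {λ n → seq y n - seq y′ n} (bounded₁ x) (null₁ y≈y′))
        (Single.null-* {seq y′} {λ n → seq x n - seq x′ n} (bounded₁ y′) (null₁ x≈x′))))

    -ʳ-cong : ∀ {x y} → x ≈ʳ y → -ʳ x ≈ʳ -ʳ y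
    -ʳ-cong {x} {y} x≈y = mk≈ (Single.null-cong 0
      (λ n _ → solve 2 (λ a b → :- (a :- b) := (:- a) :- (:- b)) refl (seq x n) (seq y n))
      (Single.null-neg {λ n → seq x n - seq y n} (null₁ x≈y)))

    +ʳ-assoc : ∀ x y z → (x +ʳ y) +ʳ z ≈ʳ x +ʳ (y +ʳ z)
    +ʳ-assoc x y z = pointwise ((x +ʳ y) +ʳ z) (x +ʳ (y +ʳ z)) λ n → +-assoc (seq x n) (seq y n) (seq z n)

    +ʳ-comm : ∀ x y → x +ʳ y ≈ʳ y +ʳ x
    +ʳ-comm x y = pointwise (x +ʳ y) (y +ʳ x) λ n → +-comm (seq x n) (seq y n)

    +ʳ-identityˡ : ∀ x → 0ʳ +ʳ x ≈ʳ x
    +ʳ-identityˡ x = pointwise (0ʳ +ʳ x) x λ n → +-identityˡ (seq x n)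

    +ʳ-identityʳ : ∀ x → x +ʳ 0ʳ ≈ʳ x
    +ʳ-identityʳ x = pointwise (x +ʳ 0ʳ) x λ n → +-identityʳ (seq x n)

    +ʳ-inverseˡ : ∀ x → -ʳ x +ʳ x ≈ʳ 0ʳ
    +ʳ-inverseˡ x = pointwise (-ʳ x +ʳ x) 0ʳ λ n → +-inverseˡ (seq x n)

    +ʳ-inverseʳ : ∀ x → x +ʳ -ʳ x ≈ʳ 0ʳ
    +ʳ-inverseʳ x = pointwise (x +ʳ -ʳ x) 0ʳ λ n → +-inverseʳ (seq x n)

    *ʳ-assoc : ∀ x y z → (x *ʳ y) *ʳ z ≈ʳ x *ʳ (y *ʳ z)
    *ʳ-assoc x y z = pointwise ((x *ʳ y) *ʳ z) (x *ʳ (y *ʳ z)) λ n → *-assoc (seq x n) (seq y n) (seq z n)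

    *ʳ-comm : ∀ x y → x *ʳ y ≈ʳ y *ʳ x
    *ʳ-comm x y = pointwise (x *ʳ y) (y *ʳ x) λ n → *-comm (seq x n) (seq y n)

    *ʳ-identityˡ : ∀ x → 1ʳ *ʳ x ≈ʳ x
    *ʳ-identityˡ x = pointwise (1ʳ *ʳ x) x λ n → *-identityˡ (seq x n)

    *ʳ-identityʳ : ∀ x → x *ʳ 1ʳ ≈ʳ x
    *ʳ-identityʳ x = pointwise (x *ʳ 1ʳ) x λ n → *-identityʳ (seq x n)

    *ʳ-distribˡ : ∀ x y z → x *ʳ (y +ʳ z) ≈ʳ x *ʳ y +ʳ x *ʳ z
    *ʳ-distribˡ x y z = pointwise (x *ʳ (y +ʳ z)) (x *ʳ y +ʳ x *ʳ z) λ n → *-distribˡ-+ (seq x n) (seq y n) (seq z n)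

    *ʳ-distribʳ : ∀ x y z → (y +ʳ z) *ʳ x ≈ʳ y *ʳ x +ʳ z *ʳ x
    *ʳ-distribʳ x y z = pointwise ((y +ʳ z) *ʳ x) (y *ʳ x +ʳ z *ʳ x) λ n → *-distribʳ-+ (seq x n) (seq y n) (seq z n)

    isCommutativeRing : IsCommutativeRing _≈ʳ_ _+ʳ_ _*ʳ_ -ʳ_ 0ʳ 1ʳ
    isCommutativeRing = record
      { isRing = record
        { +-isAbelianGroup = record
          { isGroup = record
            { isMonoid = record
              { isSemigroup = record
                { isMagma = record { isEquivalence = ≈-isEquivalence ; ∙-cong = +-congʳ′ }
                ; assoc   = +ʳ-assoc
                }
              ; identity = +ʳ-identityˡ , +ʳ-identityʳ
              }
            ; inverse = +ʳ-inverseˡ , +ʳ-inverseʳ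
            ; ⁻¹-cong = -ʳ-cong
            }
          ; comm = +ʳ-comm
          }
        ; *-cong     = *-congʳ′
        ; *-assoc    = *ʳ-assoc
        ; *-identity = *ʳ-identityˡ , *ʳ-identityʳ
        ; distrib    = *ʳ-distribˡ , *ʳ-distribʳ
        }
      ; *-comm = *ʳ-comm
      }

    Settled : ℝ → ℚ → ℕ → Set
    Settled x δ N = ∀ m n → N ℕ.≤ m → N ℕ.≤ n → ∣ seq x m - seq x n ∣ ≤ δ

    later : ∀ x δ {M N} → M ℕ.≤ N → Settled x δ M → Settled x δ N
    later x δ M≤N c m n N≤m N≤n = c m n (ℕ.≤-trans M≤N N≤m) (ℕ.≤-trans M≤N N≤n)

    -- Apartness can be read off from a single late enough pair of terms.
    apart : ∀ ε δ x y N → 0ℚ < ε → Settled x δ N → Settled y δ N →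
            (δ + δ) + ε ≤ ∣ seq x N - seq y N ∣ → x #ʳ y
    apart ε δ x y N 0<ε cx cy far = mk# ε 0<ε N λ n N≤n →
      perturb {δ} {ε} (seq x N) (seq y N) (seq x n) (seq y n)
              (cx N n ℕ.≤-refl N≤n) (cy n N N≤n ℕ.≤-refl) far

    -- One of the distances from z to x and to y is at least half of that from x to y.
    far-from-one : ∀ {η ε} p q r → η + η ≡ ε → ε ≤ ∣ p - r ∣ → η ≤ ∣ p - q ∣ ⊎ η ≤ ∣ q - r ∣
    far-from-one {η} {ε} p q r 2η≡ε far = decide (η ≤? ∣ p - q ∣) (η ≤? ∣ q - r ∣)
      where
      open ≤-Reasoning
      decide : Dec (η ≤ ∣ p - q ∣) → Dec (η ≤ ∣ q - r ∣) → η ≤ ∣ p - q ∣ ⊎ η ≤ ∣ q - r ∣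
      decide (yes pq) _        = inj₁ pq
      decide (no _)   (yes qr) = inj₂ qr
      decide (no pq)  (no qr)  = ⊥-elim (<⇒≱ (begin-strict
        ∣ p - r ∣              ≤⟨ ∣p-r∣≤ p q r ⟩
        ∣ p - q ∣ + ∣ q - r ∣  <⟨ +-mono-< (≰⇒> pq) (≰⇒> qr) ⟩
        η + η                  ≡⟨ 2η≡ε ⟩
        ε                      ∎) far)

    eventually-settled : ∀ x δ → 0ℚ < δ → ∃[ N ] Settled x δ N
    eventually-settled x δ 0<δ = cauchy x δ 0<δ

    #-cotrans : ∀ {x y} → x #ʳ y → ∀ z → x #ʳ z ⊎ z #ʳ y
    #-cotrans {x} {y} (mk# ε 0<ε M ε≤) z =
      let η , 0<η , 2η≡ε = halve 0<ε
          κ , 0<κ , 2κ≡η = halve 0<η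
          δ , 0<δ , 2δ≡κ = halve 0<κ
          X , sx = eventually-settled x δ 0<δ
          Y , sy = eventually-settled y δ 0<δ
          Z , sz = eventually-settled z δ 0<δ
          N = (M ℕ.⊔ X) ℕ.⊔ (Y ℕ.⊔ Z)
      in at η κ δ 0<κ (trans (cong (_+ κ) 2δ≡κ) 2κ≡η) N
           (later x δ (ℕ.≤-trans (ℕ.m≤n⊔m M X) (ℕ.m≤m⊔n (M ℕ.⊔ X) (Y ℕ.⊔ Z))) sx)
           (later y δ (ℕ.≤-trans (ℕ.m≤m⊔n Y Z) (ℕ.m≤n⊔m (M ℕ.⊔ X) (Y ℕ.⊔ Z))) sy)
           (later z δ (ℕ.≤-trans (ℕ.m≤n⊔m Y Z) (ℕ.m≤n⊔m (M ℕ.⊔ X) (Y ℕ.⊔ Z))) sz)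
           (far-from-one (seq x N) (seq z N) (seq y N) 2η≡ε
             (ε≤ N (ℕ.≤-trans (ℕ.m≤m⊔n M X) (ℕ.m≤m⊔n (M ℕ.⊔ X) (Y ℕ.⊔ Z)))))
      where
      at : ∀ η κ δ → 0ℚ < κ → (δ + δ) + κ ≡ η → ∀ N → Settled x δ N → Settled y δ N → Settled z δ N →
           η ≤ ∣ seq x N - seq z N ∣ ⊎ η ≤ ∣ seq z N - seq y N ∣ → x #ʳ z ⊎ z #ʳ y
      at η κ δ 0<κ refl N sx sy sz (inj₁ far) = inj₁ (apart κ δ x z N 0<κ sx sz far)
      at η κ δ 0<κ refl N sx sy sz (inj₂ far) = inj₂ (apart κ δ z y N 0<κ sz sy far)

    #-isApartness : IsApartnessRelation _≈ʳ_ _#ʳ_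
    #-isApartness = record
      { irrefl  = irr
      ; sym     = λ {x} {y} (mk# ε 0<ε N far) → mk# ε 0<ε N λ n N≤n →
          subst (ε ≤_) (∣p-q∣≡∣q-p∣ (seq x n) (seq y n)) (far n N≤n)
      ; cotrans = #-cotrans
      }
      where
      irr : ∀ {x y} → x ≈ʳ y → x #ʳ y → ⊥
      irr (mk≈ close) (mk# ε 0<ε M far) =
        let δ , 0<δ , 2δ≡ε = halve 0<ε
            N , near = close δ 0<δ
        in
        <⇒≱ (subst₂ _<_ (+-identityˡ δ) 2δ≡ε (+-monoˡ-< δ 0<δ))
            (ℚ-≤-trans (far (M ℕ.⊔ N) (ℕ.m≤m⊔n M N)) (near (M ℕ.⊔ N) (ℕ.m≤n⊔m M N)))

    tight : ∀ x y → (¬ x #ʳ y → x ≈ʳ y) × (x ≈ʳ y → ¬ x #ʳ y)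
    tight x y = (λ ¬x#y → mk≈ (lemma ¬x#y)) , IsApartnessRelation.irrefl #-isApartness
      where
      at : ¬ x #ʳ y → ∀ η δ ε → 0ℚ < η → (δ + δ) + η ≡ ε → ∀ n → Settled x δ n → Settled y δ n →
           ∣ seq x n - seq y n ∣ ≤ ε
      at ¬x#y η δ ε 0<η refl n sx sy = ≮⇒≥ λ far → ¬x#y (apart η δ x y n 0<η sx sy (<⇒≤ far))
      lemma : ¬ x #ʳ y → ∀ ε → 0ℚ < ε → ∃[ N ] ∀ n → N ℕ.≤ n → ∣ seq x n - seq y n ∣ ≤ ε
      lemma ¬x#y ε 0<ε =
        let η , 0<η , 2η≡ε = halve 0<ε
            δ , 0<δ , 2δ≡η = halve 0<η
            X , sx = eventually-settled x δ 0<δ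
            Y , sy = eventually-settled y δ 0<δ
        in X ℕ.⊔ Y , λ n N≤n →
           at ¬x#y η δ ε 0<η (trans (cong (_+ η) 2δ≡η) 2η≡ε) n
              (later x δ (ℕ.≤-trans (ℕ.m≤m⊔n X Y) N≤n) sx)
              (later y δ (ℕ.≤-trans (ℕ.m≤n⊔m X Y) N≤n) sy)

  inverse : ∀ x ε → 0ℚ < ε → ∀ N → (∀ n → N ℕ.≤ n → ε ≤ ∣ seq x n ∣) → ℝ
  inverse x ε 0<ε N ε≤ = real r (Double.null-cong N
    (λ (m , n) (N≤m , N≤n) → rearrange m n (inv m N≤m) (inv n N≤n))
    (Double.null-* {λ (m , n) → r m * r n} {λ (m , n) → - (seq x m - seq x n)}
      (Double.bounded-* {λ (m , n) → r m} {λ (m , n) → r n} (fst-bounded r-bounded) (snd-bounded r-bounded))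
      (Double.null-neg {differences (seq x)} (null₂ x))))
    where
    r : ℕ → ℚ
    r n = recip (seq x n)
    inv : ∀ n → N ℕ.≤ n → seq x n * r n ≡ 1ℚ
    inv n N≤n = recip-inverse (seq x n) 0<ε (ε≤ n N≤n)
    r-bounded : Bounded₁ r
    r-bounded = let δ , 0<δ , εδ≡1 = quotient (positive⁻¹ 1ℚ) 0<ε in
      δ , 0<δ , N , λ n N≤n → cofactor (seq x n) (r n) 0<ε (ε≤ n N≤n) (inv n N≤n) εδ≡1
    rearrange : ∀ m n → seq x m * r m ≡ 1ℚ → seq x n * r n ≡ 1ℚ →
                (r m * r n) * - (seq x m - seq x n) ≡ r m - r n
    rearrange m n xm xn = trans
      (solve 4 (λ a b c d → (c :* d) :* (:- (a :- b)) := c :* (b :* d) :- d :* (a :* c)) refl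
        (seq x m) (seq x n) (r m) (r n))
      (cong₂ _-_ (trans (cong (r m *_) xn) (*-identityʳ (r m))) (trans (cong (r n *_) xm) (*-identityʳ (r n))))

  abstract
    inverse-correct : ∀ x ε 0<ε N ε≤ → inverse x ε 0<ε N ε≤ *ʳ x ≈ʳ 1ʳ
    inverse-correct x ε 0<ε N ε≤ = mk≈ (Single.null-cong N
      (λ n N≤n → sym (trans (cong (_- 1ℚ) (trans (*-comm (recip (seq x n)) (seq x n))
                   (recip-inverse (seq x n) 0<ε (ε≤ n N≤n)))) (+-inverseʳ 1ℚ)))
      (Single.null-zero {λ _ → 0ℚ} (λ _ → refl)))

    -- If |r d - 1| ≤ ½ and |r| ≤ B then |d| ≥ 1/(2B).
    divisor-bound : ∀ {B δ} r d → 0ℚ < B → B * δ ≡ ½ → ∣ r ∣ ≤ B → ∣ r * d - 1ℚ ∣ ≤ ½ → δ ≤ ∣ d ∣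
    divisor-bound {B} {δ} r d 0<B Bδ≡½ r≤B rd≈1 = ≮⇒≥ λ small → <-irrefl refl (begin-strict
      1ℚ                             ≡⟨ cong ∣_∣ (solve 1 (λ a → con 1ℚ := (con 1ℚ :- a) :+ a) refl (r * d)) ⟩
      ∣ (1ℚ - r * d) + r * d ∣       ≤⟨ ∣p+q∣≤∣p∣+∣q∣ (1ℚ - r * d) (r * d) ⟩
      ∣ 1ℚ - r * d ∣ + ∣ r * d ∣     ≡⟨ cong₂ _+_ (∣p-q∣≡∣q-p∣ 1ℚ (r * d)) (∣p*q∣≡∣p∣*∣q∣ r d) ⟩
      ∣ r * d - 1ℚ ∣ + ∣ r ∣ * ∣ d ∣ ≤⟨ +-mono-≤ rd≈1 (*-monoʳ-≤-nonNeg ∣ d ∣ {{∣-∣-nonNeg d}} r≤B) ⟩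
      ½ + B * ∣ d ∣                  <⟨ +-monoʳ-< ½ (*-monoʳ-<-pos B {{positive 0<B}} small) ⟩
      ½ + B * δ                      ≡⟨ cong (½ +_) Bδ≡½ ⟩
      1ℚ                             ∎)
      where open ≤-Reasoning

    invertible⇒apart : ∀ x y z → z *ʳ (x +ʳ -ʳ y) ≈ʳ 1ʳ → x #ʳ y
    invertible⇒apart x y z (mk≈ close) =
      let B , 0<B , M , z≤B = bounded₁ z
          δ , 0<δ , Bδ≡½    = quotient (positive⁻¹ ½) 0<B
          N , near          = close ½ (positive⁻¹ ½)
      in mk# δ 0<δ (M ℕ.⊔ N) λ n late →
         divisor-bound (seq z n) (seq x n - seq y n) 0<B Bδ≡½
           (z≤B n (ℕ.≤-trans (ℕ.m≤m⊔n M N) late)) (near n (ℕ.≤-trans (ℕ.m≤n⊔m M N) late))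

  isHeytingField : IsHeytingField _≈ʳ_ _#ʳ_ _+ʳ_ _*ʳ_ -ʳ_ 0ʳ 1ʳ
  isHeytingField = record
    { isHeytingCommutativeRing = record
      { isCommutativeRing   = isCommutativeRing
      ; isApartnessRelation = #-isApartness
      ; #⇒invertible        = λ {x} {y} (mk# ε 0<ε N ε≤) → let p = inverse-correct (x +ʳ -ʳ y) ε 0<ε N ε≤ in
          inverse (x +ʳ -ʳ y) ε 0<ε N ε≤ , p ,
          IsEquivalence.trans ≈-isEquivalence (IsCommutativeRing.*-comm isCommutativeRing _ _) p
      ; invertible⇒#        = λ {x} {y} (z , zd≈1 , _) → invertible⇒apart x y z zd≈1
      }
    ; tight = tight
    }

-- Opaque so that comparing terms over ℝ never unfolds rational arithmetic.
opaque
  ℝ-heytingField : HeytingField 0ℓ 0ℓ 0ℓ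
  ℝ-heytingField = record { isHeytingField = ℝ-Field.isHeytingField }

module Geometry (K : HeytingField 0ℓ 0ℓ 0ℓ) where
  open HeytingField K using (Carrier; _≈_; _#_; _+_; _*_; -_; 0#; 1#; #⇒invertible; heytingCommutativeRing)
  open CommutativeRing (HeytingCommutativeRing.commutativeRing heytingCommutativeRing)
    using (setoid; +-commutativeMonoid)
  open Sum +-commutativeMonoid using (sum)
  open Equality setoid using (_≋_)

  infix  9 _⁻¹⟨_⟩
  infixl 7 _/_⟨_⟩

  -- The library supplies the inverse of x - 0# rather than that of x.
  _⁻¹⟨_⟩ : (x : Carrier) → x # 0# → Carrier
  x ⁻¹⟨ x#0 ⟩ = proj₁ (#⇒invertible x#0)

  _/_⟨_⟩ : Carrier → (y : Carrier) → y # 0# → Carrier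
  x / y ⟨ y#0 ⟩ = x * y ⁻¹⟨ y#0 ⟩

  Point : Set
  Point = Vector Carrier 3

  -- Points of projective 3-space are given by homogeneous coordinates, that is by
  -- nonzero vectors of K⁴; projective subspaces by linear subspaces of K⁴.
  Homogeneous : Set
  Homogeneous = Vector Carrier 4

  homogenise : Point → Homogeneous
  homogenise p = 1# ∷ p

  Nonzero : Homogeneous → Set
  Nonzero v = ∃[ s ] v s # 0#

  infixl 6 _⊖_
  infixr 7 _⊛_

  _⊖_ : Homogeneous → Homogeneous → Homogeneous
  (v ⊖ w) s = v s + - w s

  _⊛_ : Carrier → Homogeneous → Homogeneous
  (c ⊛ v) s = c * v s

  _·_ : Homogeneous → Homogeneous → Carrier
  h · v = sum (λ s → h s * v s)

  Subspace : Set₁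
  Subspace = Pred Homogeneous 0ℓ

  Span : ∀ {n} → Vector Homogeneous n → Subspace
  Span {n} vs v = Σ[ c ∈ Vector Carrier n ] v ≋ (λ s → sum (λ r → c r * vs r s))

  -- The projective subspace S consists of the single point P.
  IsSinglePoint : Subspace → Homogeneous → Set
  IsSinglePoint S P = Nonzero P × P ∈ S × (∀ X → Nonzero X → X ∈ S → X ∈ Span (P ∷ []))

  -- Two vectors span at most a line and three span at most a plane; when they are
  -- dependent the points lie in a smaller subspace, hence in some line or plane.
  Collinear : ∀ {n} → Vector Homogeneous n → Set
  Collinear Ps = Σ[ vs ∈ Vector Homogeneous 2 ] ∀ r → Ps r ∈ Span vs

  Coplanar : ∀ {n} → Vector Homogeneous n → Set
  Coplanar Ps = Σ[ vs ∈ Vector Homogeneous 3 ] ∀ r → Ps r ∈ Span vs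

  -- c = (P₁ - P₂)/(P₂ - P₃) · (P₃ - P₄)/(P₄ - P₁), computed in some affine chart
  -- containing the four points.  A chart is the complement of the hyperplane h = 0;
  -- the affine coordinates of a point in it are its representative with h = 1.
  record IsCrossRatio (P₁ P₂ P₃ P₄ : Homogeneous) (c : Carrier) : Set where
    field
      h           : Homogeneous
      p₁ p₂ p₃ p₄ : Homogeneous
      p₁∈P₁       : p₁ ∈ Span (P₁ ∷ [])
      p₂∈P₂       : p₂ ∈ Span (P₂ ∷ [])
      p₃∈P₃       : p₃ ∈ Span (P₃ ∷ [])
      p₄∈P₄       : p₄ ∈ Span (P₄ ∷ [])
      h·p₁≈1      : h · p₁ ≈ 1#
      h·p₂≈1      : h · p₂ ≈ 1#
      h·p₃≈1      : h · p₃ ≈ 1#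
      h·p₄≈1      : h · p₄ ≈ 1#
      p₂≉p₃       : Nonzero (p₂ ⊖ p₃)
      p₄≉p₁       : Nonzero (p₄ ⊖ p₁)
      ρ σ         : Carrier
      ratio₁      : p₁ ⊖ p₂ ≋ ρ ⊛ (p₂ ⊖ p₃)
      ratio₂      : p₃ ⊖ p₄ ≋ σ ⊛ (p₄ ⊖ p₁)
      product     : c ≈ ρ * σ

  -- y = -[P₁, S₂, P₃, S₄]⁻¹, where S₂ and S₄ are single points.
  IsWeight : Homogeneous → Subspace → Homogeneous → Subspace → Carrier → Set
  IsWeight P₁ S₂ P₃ S₄ y =
    Σ[ P₂ ∈ Homogeneous ] Σ[ P₄ ∈ Homogeneous ] Σ[ c ∈ Carrier ]
      IsSinglePoint S₂ P₂ × IsSinglePoint S₄ P₄ × IsCrossRatio P₁ P₂ P₃ P₄ c ×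
      (Σ[ c#0 ∈ c # 0# ] y ≈ - (c ⁻¹⟨ c#0 ⟩))

  ℤ³ : Set
  ℤ³ = ℤ × ℤ × ℤ

  infixl 6 _+e_

  _+e_ : ℤ³ → Fin 3 → ℤ³
  (i , j , k) +e 0F = i +ᶻ 1ℤ , j , k
  (i , j , k) +e 1F = i , j +ᶻ 1ℤ , k
  (i , j , k) +e 2F = i , j , k +ᶻ 1ℤ

  Net : Set
  Net = ℤ³ → Point

  module _ (Q : Net) where

    ⟦_⟧ : ℤ³ → Homogeneous
    ⟦ u ⟧ = homogenise (Q u)

    square : ℤ³ → Fin 3 → Fin 3 → Vector Homogeneous 4
    square u a b = ⟦ u ⟧ ∷ ⟦ u +e a ⟧ ∷ ⟦ u +e b ⟧ ∷ ⟦ u +e a +e b ⟧ ∷ []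

    IsQNet : Set
    IsQNet = ∀ u a b → a ≢ b → Coplanar (square u a b)

    line : Fin 3 → ℤ³ → Subspace
    line a u = Span (⟦ u ⟧ ∷ ⟦ u +e a ⟧ ∷ [])

    Qˣ Qʸ Qᶻ : ℤ³ → Subspace
    Qˣ = line 0F
    Qʸ = line 1F
    Qᶻ = line 2F

    -- The variables of the net, which exist when the intersections are single
    -- points and the cross-ratios are defined and invertible.
    record Weights : Set where
      field
        Yˣ Yʸ Yᶻ Ỹˣ Ỹʸ Ỹᶻ : ℤ³ → Carrier

        isYˣ : ∀ i j k → IsWeight
          ⟦ i , j , k ⟧      (Qˣ (i , j , k) ∩ Qˣ (i , j +ᶻ 1ℤ , k))
          ⟦ i +ᶻ 1ℤ , j , k ⟧ (Qˣ (i , j , k) ∩ Qˣ (i , j , k +ᶻ 1ℤ))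
          (Yˣ (i , j , k))
        isYʸ : ∀ i j k → IsWeight
          ⟦ i , j , k ⟧      (Qʸ (i , j , k) ∩ Qʸ (i , j , k +ᶻ 1ℤ))
          ⟦ i , j +ᶻ 1ℤ , k ⟧ (Qʸ (i , j , k) ∩ Qʸ (i +ᶻ 1ℤ , j , k))
          (Yʸ (i , j , k))
        isYᶻ : ∀ i j k → IsWeight
          ⟦ i , j , k ⟧      (Qᶻ (i , j , k) ∩ Qᶻ (i +ᶻ 1ℤ , j , k))
          ⟦ i , j , k +ᶻ 1ℤ ⟧ (Qᶻ (i , j , k) ∩ Qᶻ (i , j +ᶻ 1ℤ , k))
          (Yᶻ (i , j , k))

        isỸˣ : ∀ i j k → IsWeight
          ⟦ i , j , k ⟧      (Qˣ (i , j , k) ∩ Qˣ (i , j , k -ᶻ 1ℤ))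
          ⟦ i +ᶻ 1ℤ , j , k ⟧ (Qˣ (i , j , k) ∩ Qˣ (i , j -ᶻ 1ℤ , k))
          (Ỹˣ (i , j , k))
        isỸʸ : ∀ i j k → IsWeight
          ⟦ i , j , k ⟧      (Qʸ (i , j , k) ∩ Qʸ (i -ᶻ 1ℤ , j , k))
          ⟦ i , j +ᶻ 1ℤ , k ⟧ (Qʸ (i , j , k) ∩ Qʸ (i , j , k -ᶻ 1ℤ))
          (Ỹʸ (i , j , k))
        isỸᶻ : ∀ i j k → IsWeight
          ⟦ i , j , k ⟧      (Qᶻ (i , j , k) ∩ Qᶻ (i , j -ᶻ 1ℤ , k))
          ⟦ i , j , k +ᶻ 1ℤ ⟧ (Qᶻ (i , j , k) ∩ Qᶻ (i -ᶻ 1ℤ , j , k))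
          (Ỹᶻ (i , j , k))

    record IsGeneric (W : Weights) : Set where
      open Weights W
      field
        noThreeCollinear : ∀ u a b → a ≢ b → ∀ r s t → r ≢ s → s ≢ t → r ≢ t →
          let P = square u a b in ¬ Collinear (P r ∷ P s ∷ P t ∷ [])
        cornersNotCoplanar : ∀ u →
          ¬ Coplanar (⟦ u ⟧ ∷ ⟦ u +e 0F ⟧ ∷ ⟦ u +e 1F ⟧ ∷ ⟦ u +e 2F ⟧ ∷ [])
        farFacesMeetInPoint : ∀ u → ∃ (IsSinglePoint
          (Span (square (u +e 0F) 1F 2F) ∩ Span (square (u +e 1F) 0F 2F) ∩ Span (square (u +e 2F) 0F 1F)))

        Yˣ#0 : ∀ u → Yˣ u # 0#
        Yʸ#0 : ∀ u → Yʸ u # 0#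
        Yᶻ#0 : ∀ u → Yᶻ u # 0#
        1+Yˣ+YˣYʸ#0 : ∀ u → 1# + Yˣ u + Yˣ u * Yʸ u # 0#
        1+Yʸ+YʸYᶻ#0 : ∀ u → 1# + Yʸ u + Yʸ u * Yᶻ u # 0#
        1+Yᶻ+YᶻYˣ#0 : ∀ u → 1# + Yᶻ u + Yᶻ u * Yˣ u # 0#

open HeytingField ℝ-heytingField public using (_≈_; _+_; _*_; 1#)
open Geometry ℝ-heytingField public

{-# OPTIONS --safe #-}
module Submission where

-- The corner points of a cube are a basis of K⁴ and the other four points are
-- determined by the affine relations of its six faces, P₁₁ = a P₀₀ + b P₁₀ + c P₀₁.
-- The line through two points of a face meets the opposite line in a point whose
-- coordinates are read off the face relation, so every weight is, up to sign, a
-- quotient of face coefficients.  Comparing the three expressions of the last point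
-- P₁₂₃ in the basis turns the first formula into an identity of rational functions.
-- It also computes, on the edges P₂P₁₂ and P₃P₁₃, the ratio between the coordinates
-- of the two intersection points; the second formula multiplies these ratios for
-- two cubes that share such an edge.  The other formulas follow by rotating the cube.
-- Linear algebra over a Heyting field gives face relations only up to double
-- negation, which is enough because equality is stable.

open import Algebra.Apartness.Bundles using (HeytingField; HeytingCommutativeRing)
open import Algebra.Bundles using (CommutativeRing)
open import Data.Fin.Base using (Fin; zero; suc; punchIn; punchOut)
open import Data.Fin.Patterns using (0F; 1F; 2F; 3F)
open import Data.Fin.Properties using (_≟_; punchIn-punchOut; punchIn-injective)
open import Data.Integer.Base as ℤ using (ℤ; 0ℤ; 1ℤ) renaming (_+_ to _+ᶻ_; _-_ to _-ᶻ_)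
import Data.Integer.Properties as ℤ
open import Data.Nat.Base as ℕ using (ℕ; zero; suc)
open import Data.Product using (_×_; _,_; proj₁; proj₂; Σ-syntax; ∃-syntax)
open import Data.Vec.Functional using (Vector; []; _∷_; insertAt; removeAt)
open import Data.Vec.Functional.Properties using (insertAt-lookup; insertAt-punchIn)
open import Function.Base using (_∘_)
open import Level using (0ℓ)
open import Relation.Binary.PropositionalEquality as ≡ using (_≡_; _≢_)
open import Relation.Nullary using (¬_; yes; no)
open import Relation.Nullary.Negation using (contradiction; ¬¬-map)
open import Relation.Unary using (_∈_; _∩_)
open import Defs using (module Geometry)

-- A ring solver with integer coefficients.

module IntegerCoefficients {c ℓ} (R : CommutativeRing c ℓ) where
  open CommutativeRing R
  open import Algebra.Properties.Ring ring
    using (-0#≈0#; -‿distribˡ-*; -‿distribʳ-*; -‿involutive)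
  open import Algebra.Properties.AbelianGroup +-abelianGroup using (⁻¹-∙-comm)
  open import Algebra.Properties.CommutativeSemigroup +-commutativeSemigroup using (interchange)
  open import Algebra.Properties.Semiring.Mult.TCOptimised semiring
    using (×-homo-+; ×1-homo-*) renaming (_×_ to _•_)
  open import Algebra.Solver.Ring.AlmostCommutativeRing
    using (fromCommutativeRing; _-Raw-AlmostCommutative⟶_)
  open import Data.Integer.Base using (+_; -[1+_]; _⊖_)
  open import Data.Maybe.Base using (map)
  import Data.Sign.Base as Sign
  open import Relation.Nullary.Decidable using (dec⇒maybe)
  open import Relation.Binary.Reasoning.Setoid setoid

  fromℤ : ℤ → Carrier
  fromℤ (+ n)    = n • 1#
  fromℤ -[1+ n ] = - (suc n • 1#)

  fromℤ-cong : ∀ {i j} → i ≡ j → fromℤ i ≈ fromℤ j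
  fromℤ-cong ≡.refl = refl

  fromℤ-neg : ∀ i → fromℤ (ℤ.- i) ≈ - fromℤ i
  fromℤ-neg (+ zero)  = sym -0#≈0#
  fromℤ-neg (+ suc n) = refl
  fromℤ-neg -[1+ n ]  = sym (-‿involutive _)

  fromℤ-⊖ : ∀ m n → fromℤ (m ⊖ n) ≈ m • 1# - n • 1#
  fromℤ-⊖ m       zero    = sym (trans (+-congˡ -0#≈0#) (+-identityʳ (m • 1#)))
  fromℤ-⊖ zero    (suc n) = sym (+-identityˡ _)
  fromℤ-⊖ (suc m) (suc n) = begin
    fromℤ (suc m ⊖ suc n)               ≈⟨ fromℤ-cong (ℤ.[1+m]⊖[1+n]≡m⊖n m n) ⟩
    fromℤ (m ⊖ n)                       ≈⟨ fromℤ-⊖ m n ⟩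
    m • 1# - n • 1#                     ≈⟨ +-identityˡ _ ⟨
    0# + (m • 1# - n • 1#)              ≈⟨ +-congʳ (-‿inverseʳ 1#) ⟨
    (1# - 1#) + (m • 1# - n • 1#)       ≈⟨ interchange _ _ _ _ ⟩
    (1# + m • 1#) + (- 1# - n • 1#)     ≈⟨ +-congˡ (⁻¹-∙-comm _ _) ⟩
    (1# + m • 1#) - (1# + n • 1#)       ≈⟨ +-cong (×-homo-+ 1# 1 m) (-‿cong (×-homo-+ 1# 1 n)) ⟨
    suc m • 1# - suc n • 1#             ∎

  fromℤ-+ : ∀ i j → fromℤ (i ℤ.+ j) ≈ fromℤ i + fromℤ j
  fromℤ-+ (+ m)    (+ n)    = ×-homo-+ 1# m n
  fromℤ-+ (+ m)    -[1+ n ] = fromℤ-⊖ m (suc n)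
  fromℤ-+ -[1+ m ] (+ n)    = trans (fromℤ-⊖ n (suc m)) (+-comm _ _)
  fromℤ-+ -[1+ m ] -[1+ n ] = begin
    - (suc (suc (m ℕ.+ n)) • 1#)        ≈⟨ -‿cong (×-homo-+ 1# 1 (suc (m ℕ.+ n))) ⟩
    - (1# + (suc m ℕ.+ n) • 1#)         ≈⟨ -‿cong (+-congˡ (×-homo-+ 1# (suc m) n)) ⟩
    - (1# + (suc m • 1# + n • 1#))      ≈⟨ -‿cong (trans (sym (+-assoc _ _ _)) (trans (+-congʳ (+-comm _ _)) (+-assoc _ _ _))) ⟩
    - (suc m • 1# + (1# + n • 1#))      ≈⟨ -‿cong (+-congˡ (×-homo-+ 1# 1 n)) ⟨
    - (suc m • 1# + suc n • 1#)         ≈⟨ ⁻¹-∙-comm _ _ ⟨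
    - (suc m • 1#) + - (suc n • 1#)     ∎

  -- Integer multiplication delivers a product of opposite signs in this form, where `n` may be
  -- zero, so the constructor `-[1+_]` does not apply directly.
  fromℤ--◃ : ∀ n → fromℤ (Sign.- ℤ.◃ n) ≈ - (n • 1#)
  fromℤ--◃ n = trans (fromℤ-cong (ℤ.-◃n≡-n n)) (fromℤ-neg (+ n))

  fromℤ-* : ∀ i j → fromℤ (i ℤ.* j) ≈ fromℤ i * fromℤ j
  fromℤ-* (+ m)    (+ n)    = trans (fromℤ-cong (ℤ.+◃n≡+n (m ℕ.* n))) (×1-homo-* m n)
  fromℤ-* (+ m)    -[1+ n ] = begin
    fromℤ (Sign.- ℤ.◃ (m ℕ.* suc n))    ≈⟨ fromℤ--◃ (m ℕ.* suc n) ⟩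
    - ((m ℕ.* suc n) • 1#)              ≈⟨ -‿cong (×1-homo-* m (suc n)) ⟩
    - (m • 1# * suc n • 1#)             ≈⟨ -‿distribʳ-* _ _ ⟩
    m • 1# * - (suc n • 1#)             ∎
  fromℤ-* -[1+ m ] (+ n)    = begin
    fromℤ (Sign.- ℤ.◃ (suc m ℕ.* n))    ≈⟨ fromℤ--◃ (suc m ℕ.* n) ⟩
    - ((suc m ℕ.* n) • 1#)              ≈⟨ -‿cong (×1-homo-* (suc m) n) ⟩
    - (suc m • 1# * n • 1#)             ≈⟨ -‿distribˡ-* _ _ ⟩
    - (suc m • 1#) * n • 1#             ∎
  fromℤ-* -[1+ m ] -[1+ n ] = begin
    (suc m ℕ.* suc n) • 1#              ≈⟨ ×1-homo-* (suc m) (suc n) ⟩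
    suc m • 1# * suc n • 1#             ≈⟨ -‿involutive _ ⟨
    - - (suc m • 1# * suc n • 1#)       ≈⟨ -‿cong (-‿distribˡ-* _ _) ⟩
    - (- (suc m • 1#) * suc n • 1#)     ≈⟨ -‿distribʳ-* _ _ ⟩
    - (suc m • 1#) * - (suc n • 1#)     ∎

  -- The solver has to recognise cancelling coefficients, and equality in a Heyting field is not
  -- decidable. Taking coefficients in ℤ moves this test to a decidable ring.
  homomorphism : ℤ.+-*-rawRing -Raw-AlmostCommutative⟶ fromCommutativeRing R
  homomorphism = record
    { ⟦_⟧    = fromℤ
    ; +-homo = fromℤ-+
    ; *-homo = fromℤ-*
    ; -‿homo = fromℤ-neg
    ; 0-homo = refl
    ; 1-homo = refl
    }

  open import Algebra.Solver.Ring ℤ.+-*-rawRing (fromCommutativeRing R) homomorphism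
    -- Distinct integers count as unknown rather than unequal, since they may have the same image in
    -- `R`.
    (λ i j → map fromℤ-cong (dec⇒maybe (i ℤ.≟ j))) public
    using (solve; con; _:=_; _:+_; _:*_; _:-_; :-_)

-- Finite double negation and shifts of integers.

-- Finiteness of the index set is what lets the double negations be discharged one after the other.
¬¬-∀ : ∀ {n} {P : Fin n → Set} → (∀ i → ¬ ¬ P i) → ¬ ¬ (∀ i → P i)
¬¬-∀ {zero}  ¬¬P ¬∀P = ¬∀P λ ()
¬¬-∀ {suc n} ¬¬P ¬∀P = ¬¬P zero λ p → ¬¬-∀ (¬¬P ∘ suc) λ ps → ¬∀P λ { zero → p ; (suc i) → ps i }

[i-1]+1≡i : ∀ i → i -ᶻ 1ℤ +ᶻ 1ℤ ≡ i
[i-1]+1≡i i = ≡.trans (ℤ.+-assoc i _ 1ℤ) (ℤ.+-identityʳ i)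

[i+1]-1≡i : ∀ i → i +ᶻ 1ℤ -ᶻ 1ℤ ≡ i
[i+1]-1≡i i = ≡.trans (ℤ.+-assoc i 1ℤ _) (ℤ.+-identityʳ i)

-- Arithmetic in a Heyting field.

module HeytingGeometry (K : HeytingField 0ℓ 0ℓ 0ℓ) where
  open HeytingField K hiding (distrib; zero)
  open CommutativeRing (HeytingCommutativeRing.commutativeRing heytingCommutativeRing)
    using (semiring)
  open import Algebra.Apartness.Properties.HeytingCommutativeRing heytingCommutativeRing
    using (1#0; x-0≈x; x#0y#0→xy#0; invertibleʳ⇒#)
  open Geometry K hiding (line)
  open IntegerCoefficients (HeytingCommutativeRing.commutativeRing heytingCommutativeRing)
  open import Algebra.Properties.Semiring.Sum semiring
    using (sum; sum-cong-≋; sum-remove; sum-replicate-zero; ∑-distrib-+; ∑-comm; *-distribˡ-sum; *-distribʳ-sum)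
  open import Relation.Binary.Reasoning.Setoid setoid

  -- Tightness makes equality equivalent to the negation of apartness, and negations are stable.
  -- This is how objects known only up to double negation yield actual equations.
  ≈-stable : ∀ {x y} → ¬ ¬ (x ≈ y) → x ≈ y
  ≈-stable {x} {y} ¬¬x≈y = proj₁ (tight x y) λ x#y → ¬¬x≈y λ x≈y → proj₂ (tight x y) x≈y x#y

  ¬#⇒≈ : ∀ {x y} → ¬ (x # y) → x ≈ y
  ¬#⇒≈ {x} {y} = proj₁ (tight x y)

  ≈⇒¬# : ∀ {x y} → x ≈ y → ¬ (x # y)
  ≈⇒¬# {x} {y} = proj₂ (tight x y)

  ⁻¹-inverse : ∀ {x} (x#0 : x # 0#) → x * x ⁻¹⟨ x#0 ⟩ ≈ 1#
  ⁻¹-inverse {x} x#0 = trans (*-congʳ (sym (x-0≈x x))) (proj₂ (proj₂ (#⇒invertible x#0)))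

  invertible⇒#0 : ∀ {x y} → x * y ≈ 1# → x # 0#
  invertible⇒#0 {x} {y} xy≈1 = invertibleʳ⇒# (y , trans (*-congʳ (x-0≈x x)) xy≈1)

  *-cancelˡ : ∀ {x y z} → x # 0# → x * y ≈ x * z → y ≈ z
  *-cancelˡ {x} {y} {z} x#0 xy≈xz = trans (sym (strip y)) (trans (*-congˡ xy≈xz) (strip z))
    where
    i = x ⁻¹⟨ x#0 ⟩
    strip : ∀ w → i * (x * w) ≈ w
    strip w = begin
      i * (x * w)  ≈⟨ solve 3 (λ i x w → i :* (x :* w) := (x :* i) :* w) refl i x w ⟩
      (x * i) * w  ≈⟨ *-congʳ (⁻¹-inverse x#0) ⟩
      1# * w       ≈⟨ *-identityˡ w ⟩
      w            ∎

  infixl 7 _⊗_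

  _⊗_ : ∀ {x y} → x # 0# → y # 0# → x * y # 0#
  _⊗_ = x#0y#0→xy#0

  infixl 6 _⊕_
  infixr 7 _⊙_

  -- With these, l ≈ r follows from a ring identity l = r + z, where z is a linear
  -- combination of differences of equal elements.
  _⊙_ : ∀ {l r} c → l ≈ r → c * (l - r) ≈ 0#
  _⊙_ {l} {r} c l≈r = begin
    c * (l - r)  ≈⟨ *-congˡ (+-congʳ l≈r) ⟩
    c * (r - r)  ≈⟨ *-congˡ (-‿inverseʳ r) ⟩
    c * 0#       ≈⟨ zeroʳ c ⟩
    0#           ∎

  _⊕_ : ∀ {x y} → x ≈ 0# → y ≈ 0# → x + y ≈ 0#
  x≈0 ⊕ y≈0 = trans (+-cong x≈0 y≈0) (+-identityˡ 0#)

  by-combination : ∀ {l r z} → z ≈ 0# → l ≈ r + z → l ≈ r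
  by-combination {l} {r} z≈0 l≈r+z = trans l≈r+z (trans (+-congˡ z≈0) (+-identityʳ r))

  -- Linear algebra

  combination : ∀ {n m} → Vector Carrier n → Vector (Vector Carrier m) n → Vector Carrier m
  combination c vs s = sum λ r → c r * vs r s

  Relation : ∀ {n m} → Vector Carrier n → Vector (Vector Carrier m) n → Set
  Relation c vs = ∀ s → combination c vs s ≈ 0#

  -- Coefficients are required to be equal to zero, with no apartness in the conclusion; this weak
  -- form is what negative hypotheses such as non-collinearity can give.
  Independent : ∀ {n m} → Vector (Vector Carrier m) n → Set
  Independent vs = ∀ c → Relation c vs → ∀ r → c r ≈ 0#

  sum-zero : ∀ {n} {t : Vector Carrier n} → (∀ i → t i ≈ 0#) → sum t ≈ 0#
  sum-zero {n} t≈0 = trans (sum-cong-≋ t≈0) (sum-replicate-zero n)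

  -- Gaussian elimination; the pivot can only be found up to double negation.
  dependent : ∀ {n} (vs : Vector (Vector Carrier n) (suc n)) →
              ¬ ¬ (Σ[ c ∈ Vector Carrier (suc n) ] (∃[ r ] c r # 0#) × Relation c vs)
  dependent {zero}  vs none = none ((λ _ → 1#) , (zero , 1#0) , λ ())
  dependent {suc n} vs none = ¬¬pivot λ (r , p#0) → dependent (eliminated r) λ (c , nz , rel) →
                              none (extended r c , nontrivial r p#0 c nz , related r c rel)
    where
    others : Fin (suc (suc n)) → Vector (Vector Carrier (suc n)) (suc n)
    others r = removeAt vs r

    -- Elimination without division: coordinate `zero` of each row cancels.
    row : Fin (suc (suc n)) → Vector (Vector Carrier (suc n)) (suc n)
    row r j s = vs r zero * others r j s - others r j zero * vs r s

    eliminated : Fin (suc (suc n)) → Vector (Vector Carrier n) (suc n)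
    eliminated r j s = row r j (suc s)

    pivot-coefficient : Fin (suc (suc n)) → Vector Carrier (suc n) → Carrier
    pivot-coefficient r c = sum λ j → c j * others r j zero

    -- A relation between rows is pulled back to the original vectors: each other vector gets its
    -- coefficient times the pivot, and the pivot vector collects all the subtracted terms.
    extended : Fin (suc (suc n)) → Vector Carrier (suc n) → Vector Carrier (suc (suc n))
    extended r c = insertAt (λ j → c j * vs r zero) r (- pivot-coefficient r c)

    nontrivial : ∀ r → vs r zero # 0# → ∀ c → ∃[ j ] c j # 0# → ∃[ i ] extended r c i # 0#
    nontrivial r p#0 c (j , cj#0) = punchIn r j ,
      ≡.subst (_# 0#) (≡.sym (insertAt-punchIn _ r _ j)) (cj#0 ⊗ p#0)

    combined : ∀ r c s → combination (extended r c) vs s ≈ combination c (row r) s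
    combined r c s = begin
      combination (extended r c) vs s
        ≈⟨ sum-remove {i = r} (λ i → extended r c i * vs i s) ⟩
      extended r c r * vs r s + sum (λ j → extended r c (punchIn r j) * others r j s)
        ≈⟨ +-cong (*-congʳ (reflexive (insertAt-lookup _ r _)))
                  (sum-cong-≋ λ j → *-congʳ {x = others r j s}
                     (reflexive (insertAt-punchIn (λ j → c j * vs r zero) r (- pivot-coefficient r c) j))) ⟩
      - pivot-coefficient r c * vs r s + sum (λ j → c j * vs r zero * others r j s)
        ≈⟨ +-congʳ (solve 2 (λ w v → :- w :* v := w :* :- v) refl (pivot-coefficient r c) (vs r s)) ⟩
      pivot-coefficient r c * - vs r s + sum (λ j → c j * vs r zero * others r j s)
        ≈⟨ +-congʳ (*-distribʳ-sum (- vs r s) λ j → c j * others r j zero) ⟩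
      sum (λ j → c j * others r j zero * - vs r s) + sum (λ j → c j * vs r zero * others r j s)
        ≈⟨ ∑-distrib-+ (λ j → c j * others r j zero * - vs r s) (λ j → c j * vs r zero * others r j s) ⟨
      sum (λ j → c j * others r j zero * - vs r s + c j * vs r zero * others r j s)
        ≈⟨ sum-cong-≋ (λ j → solve 5 (λ c o v p u → c :* o :* :- v :+ c :* p :* u := c :* (p :* u :- o :* v))
             refl (c j) (others r j zero) (vs r s) (vs r zero) (others r j s)) ⟩
      combination c (row r) s
        ∎

    related : ∀ r c → Relation c (eliminated r) → Relation (extended r c) vs
    related r c rel zero    = trans (combined r c zero) (sum-zero λ j →
      solve 3 (λ c o v → c :* (v :* o :- o :* v) := con 0ℤ) refl (c j) (others r j zero) (vs r zero))
    related r c rel (suc s) = trans (combined r c (suc s)) (rel s)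

    -- Without a pivot all first coordinates vanish by tightness. Dropping them together with the
    -- first vector leaves a smaller instance, whose relation extends by the coefficient 0.
    ¬¬pivot : ¬ ¬ (∃[ r ] vs r zero # 0#)
    ¬¬pivot no-pivot = dependent (λ r s → vs (suc r) (suc s)) λ (c , (r , cr#0) , rel) →
      none (0# ∷ c , (suc r , cr#0) , λ where
        zero    → sum-zero λ i → trans (*-congˡ {x = (0# ∷ c) i} (¬#⇒≈ λ v#0 → no-pivot (i , v#0))) (zeroʳ _)
        (suc s) → trans (+-cong (zeroˡ _) (rel s)) (+-identityˡ 0#))

  basis∈Span : ∀ {n} (vs : Vector Homogeneous n) r → vs r ∈ Span vs
  basis∈Span vs zero    = (1# ∷ λ _ → 0#) , λ s →
    sym (trans (+-cong (*-identityˡ _) (sum-zero λ r → zeroˡ (vs (suc r) s))) (+-identityʳ _))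
  basis∈Span vs (suc r) with basis∈Span (vs ∘ suc) r
  ... | c , eq = (0# ∷ c) , λ s → trans (eq s) (sym (trans (+-congʳ (zeroˡ _)) (+-identityˡ _)))

  -- Unfolds to `Collinear` for m = 2 and to `Coplanar` for m = 3, so both are handled at once.
  Spanned : ∀ {n} → ℕ → Vector Homogeneous n → Set
  Spanned m vs = Σ[ us ∈ Vector Homogeneous m ] ∀ r → vs r ∈ Span us

  -- The coefficients over `us` form n + 1 vectors with n entries each, so `dependent` applies to
  -- them whatever the ambient dimension. Exchanging the two sums carries the relation over to `vs`.
  spanned⇒dependent : ∀ {n} (vs : Vector Homogeneous (suc n)) → Spanned n vs →
                      ¬ ¬ (Σ[ c ∈ Vector Carrier (suc n) ] (∃[ r ] c r # 0#) × Relation c vs)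
  spanned⇒dependent vs (us , vs∈us) = ¬¬-map
    (λ (c , nz , rel) → c , nz , λ s → begin
      sum (λ r → c r * vs r s)                            ≈⟨ sum-cong-≋ (λ r → *-congˡ {x = c r} (proj₂ (vs∈us r) s)) ⟩
      sum (λ r → c r * sum (λ j → d r j * us j s))        ≈⟨ sum-cong-≋ (λ r → *-distribˡ-sum (c r) λ j → d r j * us j s) ⟩
      sum (λ r → sum (λ j → c r * (d r j * us j s)))      ≈⟨ ∑-comm (λ r j → c r * (d r j * us j s)) ⟩
      sum (λ j → sum (λ r → c r * (d r j * us j s)))      ≈⟨ sum-zero (λ j → begin
        sum (λ r → c r * (d r j * us j s))                ≈⟨ sum-cong-≋ (λ r → *-assoc (c r) (d r j) (us j s)) ⟨
        sum (λ r → c r * d r j * us j s)                  ≈⟨ *-distribʳ-sum (us j s) (λ r → c r * d r j) ⟨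
        sum (λ r → c r * d r j) * us j s                  ≈⟨ *-congʳ (rel j) ⟩
        0# * us j s                                       ≈⟨ zeroˡ _ ⟩
        0#                                                ∎) ⟩
      0#                                                  ∎)
    (dependent d)
    where
    d = λ r → proj₁ (vs∈us r)

  -- A coefficient apart from zero would allow its vector to be solved for, placing all vectors in
  -- the span of the n others. So no coefficient is apart from zero, and tightness makes each of
  -- them zero.
  ¬spanned⇒independent : ∀ {n} (vs : Vector Homogeneous (suc n)) → ¬ Spanned n vs → Independent vs
  ¬spanned⇒independent vs ¬spanned c rel r = ¬#⇒≈ λ c#0 → ¬spanned (removeAt vs r , spans c#0)
    where
    spans : c r # 0# → ∀ r′ → vs r′ ∈ Span (removeAt vs r)
    spans c#0 r′ with r ≟ r′
    ... | no r≢r′    = ≡.subst (λ i → vs i ∈ Span (removeAt vs r)) (punchIn-punchOut r≢r′)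
                         (basis∈Span (removeAt vs r) (punchOut r≢r′))
    ... | yes ≡.refl = (λ j → - i * c (punchIn r j)) , λ s → *-cancelˡ c#0 (begin
      c r * vs r s                               ≈⟨ +-identityʳ _ ⟨
      c r * vs r s + 0#                          ≈⟨ +-congˡ (-‿inverseʳ (rest s)) ⟨
      c r * vs r s + (rest s - rest s)           ≈⟨ +-assoc _ _ _ ⟨
      c r * vs r s + rest s - rest s             ≈⟨ +-congʳ (sum-remove {i = r} λ j → c j * vs j s) ⟨
      combination c vs s - rest s                ≈⟨ +-congʳ (rel s) ⟩
      0# - rest s                                ≈⟨ solve 1 (λ t → con 0ℤ :- t := (:- con 1ℤ) :* t) refl (rest s) ⟩
      - 1# * rest s                              ≈⟨ *-congʳ (-‿cong (⁻¹-inverse c#0)) ⟨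
      - (c r * i) * rest s                       ≈⟨ solve 3 (λ c i t → (:- (c :* i)) :* t := c :* ((:- i) :* t))
                                                      refl (c r) i (rest s) ⟩
      c r * (- i * rest s)                       ≈⟨ *-congˡ (*-distribˡ-sum (- i) λ j → d j * us j s) ⟩
      c r * sum (λ j → - i * (d j * us j s))     ≈⟨ *-congˡ (sum-cong-≋ λ j → *-assoc (- i) (d j) (us j s)) ⟨
      c r * sum (λ j → - i * d j * us j s)       ∎)
      where
      i = c r ⁻¹⟨ c#0 ⟩
      d = removeAt c r
      us = removeAt vs r
      rest = combination d us

  -- These vectors form a circuit in the sense of matroids. If one coefficient of a relation
  -- vanished, the rest would be a relation between independent vectors and vanish too,
  -- contradicting the coefficient known to be apart from zero.
  circuit : ∀ {n} (vs : Vector Homogeneous (suc n)) → Spanned n vs → (∀ r → Independent (removeAt vs r)) →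
            ¬ ¬ (Σ[ c ∈ Vector Carrier (suc n) ] (∀ r → c r # 0#) × Relation c vs)
  circuit vs spanned independent none = spanned⇒dependent vs spanned λ (c , (r₀ , c#0) , rel) →
    ¬¬-∀ (λ r ¬c#0 → ≈⇒¬# (vanishes c rel r (¬#⇒≈ ¬c#0) r₀) c#0) λ all#0 → none (c , all#0 , rel)
    where
    vanishes : ∀ c → Relation c vs → ∀ r → c r ≈ 0# → ∀ r′ → c r′ ≈ 0#
    vanishes c rel r cr≈0 r′ with r ≟ r′
    ... | yes ≡.refl = cr≈0
    ... | no r≢r′    = ≡.subst (λ i → c i ≈ 0#) (punchIn-punchOut r≢r′)
      (independent r (removeAt c r) (λ s → begin
        combination (removeAt c r) (removeAt vs r) s                  ≈⟨ +-identityˡ _ ⟨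
        0# + combination (removeAt c r) (removeAt vs r) s             ≈⟨ +-congʳ (trans (*-congʳ cr≈0) (zeroˡ _)) ⟨
        c r * vs r s + combination (removeAt c r) (removeAt vs r) s   ≈⟨ sum-remove {i = r} (λ i → c i * vs i s) ⟨
        combination c vs s                                            ≈⟨ rel s ⟩
        0#                                                            ∎) (punchOut r≢r′))

  independent-injective : ∀ {n m} (vs : Vector (Vector Carrier m) n) → Independent vs → ∀ c d →
                          (∀ s → combination c vs s ≈ combination d vs s) → ∀ r → c r ≈ d r
  independent-injective vs independent c d c≈d r = begin
    c r              ≈⟨ solve 2 (λ c d → c := (c :- d) :+ d) refl (c r) (d r) ⟩
    c r - d r + d r  ≈⟨ +-congʳ (independent (λ i → c i - d i) difference r) ⟩
    0# + d r         ≈⟨ +-identityˡ _ ⟩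
    d r              ∎
    where
    difference : Relation (λ i → c i - d i) vs
    difference s = begin
      sum (λ i → (c i - d i) * vs i s)                       ≈⟨ sum-cong-≋ (λ i → solve 3
                                                                     (λ c d v → (c :- d) :* v := c :* v :+ (:- con 1ℤ) :* (d :* v))
                                                                     refl (c i) (d i) (vs i s)) ⟩
      sum (λ i → c i * vs i s + - 1# * (d i * vs i s))       ≈⟨ ∑-distrib-+ (λ i → c i * vs i s) _ ⟩
      combination c vs s + sum (λ i → - 1# * (d i * vs i s)) ≈⟨ +-congˡ (*-distribˡ-sum (- 1#) λ i → d i * vs i s) ⟨
      combination c vs s + - 1# * combination d vs s         ≈⟨ +-congʳ (c≈d s) ⟩
      combination d vs s + - 1# * combination d vs s         ≈⟨ solve 1 (λ t → t :+ (:- con 1ℤ) :* t := con 0ℤ)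
                                                                  refl (combination d vs s) ⟩
      0#                                                     ∎

  -- Faces and cross-ratios

  -- A nondegenerate planar square in explicit form. The field `independent` treats the triple
  -- without P₁₁; `a`, `b`, `c` being apart from zero treats the three triples that contain it.
  record Face (P₀₀ P₁₀ P₀₁ P₁₁ : Homogeneous) : Set where
    field
      a b c       : Carrier
      a#0         : a # 0#
      b#0         : b # 0#
      c#0         : c # 0#
      independent : Independent (P₀₀ ∷ P₁₀ ∷ P₀₁ ∷ [])
      P₁₁≈        : ∀ s → P₁₁ s ≈ a * P₀₀ s + b * P₁₀ s + c * P₀₁ s

  -- Exchanges the two directions of the face, so that statements about one pair of opposite edges
  -- also serve the other pair.
  swap : ∀ {P₀₀ P₁₀ P₀₁ P₁₁} → Face P₀₀ P₁₀ P₀₁ P₁₁ → Face P₀₀ P₀₁ P₁₀ P₁₁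
  swap {P₀₀} {P₁₀} {P₀₁} F = record
    { a = a ; b = c ; c = b ; a#0 = a#0 ; b#0 = c#0 ; c#0 = b#0
    ; independent = λ x rel →
        let ≈0 = independent (x 0F ∷ x 2F ∷ x 1F ∷ []) λ s → trans
                   (solve 6 (λ x y z p q r → x :* p :+ (z :* r :+ (y :* q :+ con 0ℤ)) := x :* p :+ (y :* q :+ (z :* r :+ con 0ℤ)))
                      refl (x 0F) (x 1F) (x 2F) (P₀₀ s) (P₀₁ s) (P₁₀ s))
                   (rel s)
        in λ { 0F → ≈0 0F ; 1F → ≈0 2F ; 2F → ≈0 1F }
    ; P₁₁≈ = λ s → trans (P₁₁≈ s) (solve 3 (λ x y z → x :+ y :+ z := x :+ z :+ y) refl
               (a * P₀₀ s) (b * P₁₀ s) (c * P₀₁ s))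
    }
    where open Face F

  -- The points of S on the line through E and E′ are multiples of aE + bE′.
  Meets : Homogeneous → Homogeneous → Subspace → Carrier → Carrier → Set
  Meets E E′ S a b = ∀ {v} → v ∈ S →
    Σ[ α ∈ Carrier ] Σ[ β ∈ Carrier ] (∀ s → v s ≈ α * E s + β * E′ s) × α * b ≈ β * a

  module _ {P₀₀ P₁₀ P₀₁ P₁₁} (F : Face P₀₀ P₁₀ P₀₁ P₁₁) where
    open Face F

    near-independent : Independent (P₀₀ ∷ P₁₀ ∷ [])
    near-independent x rel = λ { 0F → ≈0 0F ; 1F → ≈0 1F }
      where
      ≈0 = independent (x 0F ∷ x 1F ∷ 0# ∷ []) λ s → trans
        (solve 5 (λ x y p q r → x :* p :+ (y :* q :+ (con 0ℤ :* r :+ con 0ℤ)) := x :* p :+ (y :* q :+ con 0ℤ))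
           refl (x 0F) (x 1F) (P₀₀ s) (P₁₀ s) (P₀₁ s))
        (rel s)

    -- Write v = xP₀₀ + x′P₁₀ = yP₀₁ + y′P₁₁ and substitute the face relation. Comparing
    -- coefficients gives x = y′a and x′ = y′b, hence xb = x′a.
    near-meets : Meets P₀₀ P₁₀ (Span (P₀₀ ∷ P₁₀ ∷ []) ∩ Span (P₀₁ ∷ P₁₁ ∷ [])) a b
    near-meets {v} ((x , v≈x) , (y , v≈y)) = x 0F , x 1F , (λ s → trans (v≈x s) (+-congˡ (+-identityʳ _))) ,
      by-combination (b ⊙ ≈0 0F ⊕ (- a) ⊙ ≈0 1F)
        (solve 5 (λ x x′ y a b →
          x :* b := x′ :* a :+ (b :* (x :- y :* a :- con 0ℤ) :+ (:- a) :* (x′ :- y :* b :- con 0ℤ)))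
          refl (x 0F) (x 1F) (y 1F) a b)
      where
      ≈0 = independent (x 0F - y 1F * a ∷ x 1F - y 1F * b ∷ - (y 0F + y 1F * c) ∷ []) λ s → by-combination
        ((- 1#) ⊙ v≈x s ⊕ 1# ⊙ v≈y s ⊕ y 1F ⊙ P₁₁≈ s)
        (solve 12 (λ x x′ y y′ a b c p q r t v →
          (x :- y′ :* a) :* p :+ ((x′ :- y′ :* b) :* q :+ ((:- (y :+ y′ :* c)) :* r :+ con 0ℤ))
          := con 0ℤ :+ ((:- con 1ℤ) :* (v :- (x :* p :+ (x′ :* q :+ con 0ℤ)))
               :+ con 1ℤ :* (v :- (y :* r :+ (y′ :* t :+ con 0ℤ)))
               :+ y′ :* (t :- (a :* p :+ b :* q :+ c :* r))))
          refl (x 0F) (x 1F) (y 0F) (y 1F) a b c (P₀₀ s) (P₁₀ s) (P₀₁ s) (P₁₁ s) (v s))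

    -- After P₁₁ is expanded, the coefficient of P₀₀ is x′a with `a` invertible. This kills x′, and
    -- the coefficient of P₀₁ then kills x.
    far-independent : Independent (P₀₁ ∷ P₁₁ ∷ [])
    far-independent x rel = λ { 0F → x₀≈0 ; 1F → x₁≈0 }
      where
      ≈0 = independent (x 1F * a ∷ x 1F * b ∷ x 0F + x 1F * c ∷ []) λ s → by-combination
        (1# ⊙ rel s ⊕ (- x 1F) ⊙ P₁₁≈ s)
        (solve 9 (λ x x′ a b c p q r t →
          x′ :* a :* p :+ (x′ :* b :* q :+ ((x :+ x′ :* c) :* r :+ con 0ℤ))
          := con 0ℤ :+ (con 1ℤ :* (x :* r :+ (x′ :* t :+ con 0ℤ) :- con 0ℤ)
               :+ (:- x′) :* (t :- (a :* p :+ b :* q :+ c :* r))))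
          refl (x 0F) (x 1F) a b c (P₀₀ s) (P₁₀ s) (P₀₁ s) (P₁₁ s))
      x₁≈0 = *-cancelˡ a#0 (trans (trans (*-comm a (x 1F)) (≈0 0F)) (sym (zeroʳ a)))
      x₀≈0 = by-combination (1# ⊙ ≈0 2F ⊕ (- c) ⊙ x₁≈0)
        (solve 3 (λ x x′ c → x := con 0ℤ :+ (con 1ℤ :* (x :+ x′ :* c :- con 0ℤ) :+ (:- c) :* (x′ :- con 0ℤ)))
           refl (x 0F) (x 1F) c)

    -- In xP₀₁ + x′P₁₁ the coefficient x + x′c of P₀₁ has to vanish, so v is proportional to cP₀₁ -
    -- P₁₁. This is the same point as in `near-meets`, seen from the opposite edge.
    far-meets : Meets P₀₁ P₁₁ (Span (P₀₁ ∷ P₁₁ ∷ []) ∩ Span (P₀₀ ∷ P₁₀ ∷ [])) c (- 1#)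
    far-meets {v} ((x , v≈x) , (y , v≈y)) = x 0F , x 1F , (λ s → trans (v≈x s) (+-congˡ (+-identityʳ _))) ,
      by-combination ((- 1#) ⊙ ≈0 2F)
        (solve 3 (λ x x′ c → x :* (:- con 1ℤ) := x′ :* c :+ (:- con 1ℤ) :* (x :+ x′ :* c :- con 0ℤ))
           refl (x 0F) (x 1F) c)
      where
      ≈0 = independent (x 1F * a - y 0F ∷ x 1F * b - y 1F ∷ x 0F + x 1F * c ∷ []) λ s → by-combination
        ((- 1#) ⊙ v≈x s ⊕ 1# ⊙ v≈y s ⊕ (- x 1F) ⊙ P₁₁≈ s)
        (solve 12 (λ x x′ y y′ a b c p q r t v →
          (x′ :* a :- y) :* p :+ ((x′ :* b :- y′) :* q :+ ((x :+ x′ :* c) :* r :+ con 0ℤ))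
          := con 0ℤ :+ ((:- con 1ℤ) :* (v :- (x :* r :+ (x′ :* t :+ con 0ℤ)))
               :+ con 1ℤ :* (v :- (y :* p :+ (y′ :* q :+ con 0ℤ)))
               :+ (:- x′) :* (t :- (a :* p :+ b :* q :+ c :* r))))
          refl (x 0F) (x 1F) (y 0F) (y 1F) a b c (P₀₀ s) (P₁₀ s) (P₀₁ s) (P₁₁ s) (v s))

  -- Because p - q = ρ(q - p′) makes q proportional to p + ρp′.
  division-ratio : ∀ {E E′ a b μ μ′ α β ρ} {p q p′ : Homogeneous} → Independent (E ∷ E′ ∷ []) →
    (∀ s → p s ≈ μ * E s + 0#) → (∀ s → p′ s ≈ μ′ * E′ s + 0#) →
    (∀ s → q s ≈ α * E s + β * E′ s) → α * b ≈ β * a →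
    (∀ s → p s - q s ≈ ρ * (q s - p′ s)) → a * (ρ * μ′) ≈ b * μ
  division-ratio {E} {E′} {a} {b} {μ} {μ′} {α} {β} {ρ} {p} {q} {p′} independent p≈ p′≈ q≈ αb≈βa ratio = by-combination
    ((- b) ⊙ ≈0 0F ⊕ a ⊙ ≈0 1F ⊕ (- (1# + ρ)) ⊙ αb≈βa)
    (solve 7 (λ a b μ μ′ α β ρ → a :* (ρ :* μ′) := b :* μ
      :+ ((:- b) :* (μ :- (con 1ℤ :+ ρ) :* α :- con 0ℤ) :+ a :* (ρ :* μ′ :- (con 1ℤ :+ ρ) :* β :- con 0ℤ)
          :+ (:- (con 1ℤ :+ ρ)) :* (α :* b :- β :* a)))
      refl a b μ μ′ α β ρ)
    where
    ≈0 = independent (μ - (1# + ρ) * α ∷ ρ * μ′ - (1# + ρ) * β ∷ []) λ s → by-combination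
      (1# ⊙ ratio s ⊕ (- 1#) ⊙ p≈ s ⊕ (- ρ) ⊙ p′≈ s ⊕ (1# + ρ) ⊙ q≈ s)
      (solve 10 (λ μ μ′ α β ρ e e′ p q p′ →
        (μ :- (con 1ℤ :+ ρ) :* α) :* e :+ ((ρ :* μ′ :- (con 1ℤ :+ ρ) :* β) :* e′ :+ con 0ℤ)
        := con 0ℤ :+ (con 1ℤ :* ((p :- q) :- ρ :* (q :- p′)) :+ (:- con 1ℤ) :* (p :- (μ :* e :+ con 0ℤ))
             :+ (:- ρ) :* (p′ :- (μ′ :* e′ :+ con 0ℤ)) :+ (con 1ℤ :+ ρ) :* (q :- (α :* e :+ β :* e′))))
        refl μ μ′ α β ρ (E s) (E′ s) (p s) (q s) (p′ s))

  -- The normalisation h · p = 1 exhibits h · P as an inverse of μ.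
  multiple#0 : ∀ {μ} {p P : Homogeneous} h → (∀ s → p s ≈ μ * P s + 0#) → h · p ≈ 1# → μ # 0#
  multiple#0 {μ} {p} {P} h p≈ h·p≈1 = invertible⇒#0 (begin
    μ * (h · P)                  ≈⟨ *-distribˡ-sum μ (λ s → h s * P s) ⟩
    sum (λ s → μ * (h s * P s))  ≈⟨ sum-cong-≋ (λ s → trans
                                      (solve 3 (λ μ h v → μ :* (h :* v) := h :* (μ :* v :+ con 0ℤ)) refl μ (h s) (P s))
                                      (*-congˡ {x = h s} (sym (p≈ s)))) ⟩
    h · p                        ≈⟨ h·p≈1 ⟩
    1#                           ∎)

  independent-swap : ∀ {E E′ : Homogeneous} → Independent (E ∷ E′ ∷ []) → Independent (E′ ∷ E ∷ [])
  independent-swap {E} {E′} independent x rel = λ { 0F → ≈0 1F ; 1F → ≈0 0F }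
    where
    ≈0 = independent (x 1F ∷ x 0F ∷ []) λ s → trans
      (solve 4 (λ x y p q → y :* q :+ (x :* p :+ con 0ℤ) := x :* p :+ (y :* q :+ con 0ℤ)) refl (x 0F) (x 1F) (E′ s) (E s))
      (rel s)

  -- With μ₁ and μ₃ the scales of the chart representatives, the two division ratios are ρ =
  -- bμ₁/(aμ₃) and σ = a′μ₃/(b′μ₁). The scales cancel in the product, leaving c = ba′/(ab′) whatever
  -- the chart, and y = -1/c.
  weight : ∀ {P₁ P₃ S₂ S₄ a b a′ b′ y} → Independent (P₁ ∷ P₃ ∷ []) →
    Meets P₁ P₃ S₂ a b → Meets P₁ P₃ S₄ a′ b′ → IsWeight P₁ S₂ P₃ S₄ y → y * (b * a′) ≈ - (a * b′)
  weight {P₁} {P₃} {a = a} {b} {a′} {b′} {y} independent meets₂ meets₄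
         (P₂ , P₄ , c , (_ , P₂∈S₂ , _) , (_ , P₄∈S₄ , _) , cross-ratio , c#0 , y≈)
    with meets₂ P₂∈S₂ | meets₄ P₄∈S₄
  ... | α₂ , β₂ , P₂≈ , α₂b≈β₂a | α₄ , β₄ , P₄≈ , α₄b′≈β₄a′ = begin
    y * (b * a′)                      ≈⟨ *-cong y≈ ba′≈ ⟩
    - (c ⁻¹⟨ c#0 ⟩) * (c * (a * b′))  ≈⟨ solve 3 (λ c i t → (:- i) :* (c :* t) := (c :* i) :* (:- t)) refl c (c ⁻¹⟨ c#0 ⟩) (a * b′) ⟩
    (c * c ⁻¹⟨ c#0 ⟩) * - (a * b′)    ≈⟨ *-congʳ (⁻¹-inverse c#0) ⟩
    1# * - (a * b′)                   ≈⟨ *-identityˡ _ ⟩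
    - (a * b′)                        ∎
    where
    open IsCrossRatio cross-ratio
    μ₁ = proj₁ p₁∈P₁ 0F
    μ₂ = proj₁ p₂∈P₂ 0F
    μ₃ = proj₁ p₃∈P₃ 0F
    μ₄ = proj₁ p₄∈P₄ 0F
    ratio₁′ : a * (ρ * μ₃) ≈ b * μ₁
    ratio₁′ = division-ratio {α = μ₂ * α₂} {β = μ₂ * β₂} independent (proj₂ p₁∈P₁) (proj₂ p₃∈P₃)
      (λ s → trans (proj₂ p₂∈P₂ s) (trans (+-congʳ (*-congˡ (P₂≈ s)))
        (solve 5 (λ m α β e e′ → m :* (α :* e :+ β :* e′) :+ con 0ℤ := m :* α :* e :+ m :* β :* e′)
           refl μ₂ α₂ β₂ (P₁ s) (P₃ s))))
      (trans (*-assoc _ _ _) (trans (*-congˡ α₂b≈β₂a) (sym (*-assoc _ _ _))))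
      ratio₁
    -- The second factor of the cross-ratio runs from p₃ to p₁, so the endpoints and their
    -- coordinates change places.
    ratio₂′ : b′ * (σ * μ₁) ≈ a′ * μ₃
    ratio₂′ = division-ratio {α = μ₄ * β₄} {β = μ₄ * α₄} (independent-swap independent) (proj₂ p₃∈P₃) (proj₂ p₁∈P₁)
      (λ s → trans (proj₂ p₄∈P₄ s) (trans (+-congʳ (*-congˡ (P₄≈ s)))
        (solve 5 (λ m α β e e′ → m :* (α :* e :+ β :* e′) :+ con 0ℤ := m :* β :* e′ :+ m :* α :* e)
           refl μ₄ α₄ β₄ (P₁ s) (P₃ s))))
      (trans (*-assoc _ _ _) (trans (*-congˡ (sym α₄b′≈β₄a′)) (sym (*-assoc _ _ _))))
      ratio₂
    ba′≈ : b * a′ ≈ c * (a * b′)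
    ba′≈ = *-cancelˡ (multiple#0 h (proj₂ p₁∈P₁) h·p₁≈1 ⊗ multiple#0 h (proj₂ p₃∈P₃) h·p₃≈1) (begin
      μ₁ * μ₃ * (b * a′)                 ≈⟨ solve 4 (λ m m′ b a → m :* m′ :* (b :* a) := (b :* m) :* (a :* m′)) refl μ₁ μ₃ b a′ ⟩
      (b * μ₁) * (a′ * μ₃)               ≈⟨ *-cong ratio₁′ ratio₂′ ⟨
      (a * (ρ * μ₃)) * (b′ * (σ * μ₁))   ≈⟨ solve 6 (λ m m′ a b ρ σ → (a :* (ρ :* m′)) :* (b :* (σ :* m)) := m :* m′ :* ((ρ :* σ) :* (a :* b)))
                                             refl μ₁ μ₃ a b′ ρ σ ⟩
      μ₁ * μ₃ * ((ρ * σ) * (a * b′))     ≈⟨ *-congˡ (*-congʳ product) ⟨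
      μ₁ * μ₃ * (c * (a * b′))           ∎)

  -- Polynomial identities between face coefficients.

  -- The coefficients x, y, z and X, Y, Z belong to the faces of a cube that are
  -- orthogonal to the directions 1, 2, 3 and contain P or P₁₂₃, respectively; A, B, C
  -- are the weights of the edges at P.

  -- Here A = -z₀y₁/(z₁y₀) and B = -x₀z₂/(x₂z₀). The factor z₀ cancels in BA, so z₁y₀x₂ is already a
  -- common denominator.
  numerator : ∀ x₀ x₂ y₀ y₁ z₀ z₁ z₂ A B → A * (z₁ * y₀) ≈ - (z₀ * y₁) → B * (x₂ * z₀) ≈ - (x₀ * z₂) →
    (1# + A + B * A) * (z₁ * y₀ * x₂) ≈ z₁ * y₀ * x₂ - z₀ * y₁ * x₂ + x₀ * z₂ * y₁
  numerator x₀ x₂ y₀ y₁ z₀ z₁ z₂ A B eA eB = by-combination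
    (((x₂ + B * x₂) ⊙ eA) ⊕ ((- y₁) ⊙ eB))
    (solve 9 (λ x₀ x₂ y₀ y₁ z₀ z₁ z₂ A B →
      (con 1ℤ :+ A :+ B :* A) :* (z₁ :* y₀ :* x₂)
        := (z₁ :* y₀ :* x₂ :- z₀ :* y₁ :* x₂ :+ x₀ :* z₂ :* y₁)
           :+ ((x₂ :+ B :* x₂) :* (A :* (z₁ :* y₀) :- (:- (z₀ :* y₁)))
               :+ (:- y₁) :* (B :* (x₂ :* z₀) :- (:- (x₀ :* z₂)))))
      refl x₀ x₂ y₀ y₁ z₀ z₁ z₂ A B)

  -- The hypotheses compare coordinates of P₁₂₃. The multipliers are chosen to eliminate X₁, X₂, Y₁
  -- and Z₁; what remains relates Y₂ to Z₂, whose quotient is up to sign the weight of the edge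
  -- P₂₃P₁₂₃. The bracketed polynomials are those of `numerator` and `denominator`.
  far-edge-identity : ∀ x₀ x₂ x₃ y₀ y₁ y₃ z₀ z₁ z₂ X₁ X₂ Y₁ Y₂ Z₁ Z₂ →
    X₁ * z₀ + X₂ * y₀ ≈ Y₁ * z₀ + Y₂ * x₀ →
    Y₁ * z₀ + Y₂ * x₀ ≈ Z₁ * y₀ + Z₂ * x₀ →
    Y₁ * z₁ ≈ Z₁ * y₁ →
    X₁ * z₂ ≈ Z₂ * x₂ →
    X₂ * y₃ ≈ Y₂ * x₃ →
    y₃ * z₀ * Z₂ * (z₁ * y₀ * x₂ - z₀ * y₁ * x₂ + x₀ * z₂ * y₁)
      ≈ z₂ * y₀ * Y₂ * (y₃ * x₀ * z₁ - x₃ * y₀ * z₁ + x₃ * z₀ * y₁)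
  far-edge-identity x₀ x₂ x₃ y₀ y₁ y₃ z₀ z₁ z₂ X₁ X₂ Y₁ Y₂ Z₁ Z₂ e₁ e₂ e₃ e₄ e₅ = by-combination
    ((z₂ * y₃ * (z₁ * y₀ - y₁ * z₀)) ⊙ e₁ ⊕ (- (z₂ * y₃ * y₁ * z₀)) ⊙ e₂ ⊕ (z₂ * y₃ * z₀ * y₀) ⊙ e₃
      ⊕ (- (y₃ * z₀ * (z₁ * y₀ - y₁ * z₀))) ⊙ e₄ ⊕ (- (z₂ * y₀ * (z₁ * y₀ - y₁ * z₀))) ⊙ e₅)
    (solve 15 (λ x₀ x₂ x₃ y₀ y₁ y₃ z₀ z₁ z₂ X₁ X₂ Y₁ Y₂ Z₁ Z₂ →
      y₃ :* z₀ :* Z₂ :* (z₁ :* y₀ :* x₂ :- z₀ :* y₁ :* x₂ :+ x₀ :* z₂ :* y₁)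
      := z₂ :* y₀ :* Y₂ :* (y₃ :* x₀ :* z₁ :- x₃ :* y₀ :* z₁ :+ x₃ :* z₀ :* y₁)
        :+ ((z₂ :* y₃ :* (z₁ :* y₀ :- y₁ :* z₀)) :* ((X₁ :* z₀ :+ X₂ :* y₀) :- (Y₁ :* z₀ :+ Y₂ :* x₀))
        :+ (:- (z₂ :* y₃ :* y₁ :* z₀)) :* ((Y₁ :* z₀ :+ Y₂ :* x₀) :- (Z₁ :* y₀ :+ Z₂ :* x₀))
        :+ (z₂ :* y₃ :* z₀ :* y₀) :* (Y₁ :* z₁ :- Z₁ :* y₁)
        :+ (:- (y₃ :* z₀ :* (z₁ :* y₀ :- y₁ :* z₀))) :* (X₁ :* z₂ :- Z₂ :* x₂)
        :+ (:- (z₂ :* y₀ :* (z₁ :* y₀ :- y₁ :* z₀))) :* (X₂ :* y₃ :- Y₂ :* x₃)))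
      refl x₀ x₂ x₃ y₀ y₁ y₃ z₀ z₁ z₂ X₁ X₂ Y₁ Y₂ Z₁ Z₂)

  denominator : ∀ x₀ x₃ y₀ y₁ y₃ z₀ z₁ A C → A * (z₁ * y₀) ≈ - (z₀ * y₁) → C * (y₃ * x₀) ≈ - (y₀ * x₃) →
    (1# + C + C * A) * (y₃ * x₀ * z₁) ≈ y₃ * x₀ * z₁ - x₃ * y₀ * z₁ + x₃ * z₀ * y₁
  denominator x₀ x₃ y₀ y₁ y₃ z₀ z₁ A C eA eC = by-combination
    ((z₁ + A * z₁) ⊙ eC ⊕ (- x₃) ⊙ eA)
    (solve 9 (λ x₀ x₃ y₀ y₁ y₃ z₀ z₁ A C →
      (con 1ℤ :+ C :+ C :* A) :* (y₃ :* x₀ :* z₁)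
      := (y₃ :* x₀ :* z₁ :- x₃ :* y₀ :* z₁ :+ x₃ :* z₀ :* y₁)
         :+ ((z₁ :+ A :* z₁) :* (C :* (y₃ :* x₀) :- (:- (y₀ :* x₃)))
             :+ (:- x₃) :* (A :* (z₁ :* y₀) :- (:- (z₀ :* y₁)))))
      refl x₀ x₃ y₀ y₁ y₃ z₀ z₁ A C)

  -- Comparing the coordinates of P₁₂₃ along P, P₁ and P₂ suffices to eliminate Y₂, Z₁ and Z₂, which
  -- leaves the ratio of Y₀ to Y₁.
  edge₂-identity : ∀ x₀ x₂ y₀ y₁ z₀ z₁ z₂ Y₀ Y₁ Y₂ Z₁ Z₂ →
    Y₁ * z₀ + Y₂ * x₀ ≈ Z₁ * y₀ + Z₂ * x₀ →
    Y₁ * z₁ ≈ Z₁ * y₁ →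
    Y₀ + Y₁ * z₂ + Y₂ * x₂ ≈ Z₂ * x₂ →
    Y₁ * (z₁ * y₀ * x₂ - z₀ * y₁ * x₂ + x₀ * z₂ * y₁) ≈ - (Y₀ * (x₀ * y₁))
  edge₂-identity x₀ x₂ y₀ y₁ z₀ z₁ z₂ Y₀ Y₁ Y₂ Z₁ Z₂ e₀ e₁ e₂ = by-combination
    ((- (x₂ * y₁)) ⊙ e₀ ⊕ (x₂ * y₀) ⊙ e₁ ⊕ (x₀ * y₁) ⊙ e₂)
    (solve 12 (λ x₀ x₂ y₀ y₁ z₀ z₁ z₂ Y₀ Y₁ Y₂ Z₁ Z₂ →
      Y₁ :* (z₁ :* y₀ :* x₂ :- z₀ :* y₁ :* x₂ :+ x₀ :* z₂ :* y₁)
      := :- (Y₀ :* (x₀ :* y₁))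
        :+ ((:- (x₂ :* y₁)) :* ((Y₁ :* z₀ :+ Y₂ :* x₀) :- (Z₁ :* y₀ :+ Z₂ :* x₀))
        :+ (x₂ :* y₀) :* (Y₁ :* z₁ :- Z₁ :* y₁)
        :+ (x₀ :* y₁) :* ((Y₀ :+ Y₁ :* z₂ :+ Y₂ :* x₂) :- Z₂ :* x₂)))
      refl x₀ x₂ y₀ y₁ z₀ z₁ z₂ Y₀ Y₁ Y₂ Z₁ Z₂)

  -- The counterpart for direction 3: the coordinates along P, P₁ and P₃ eliminate Y₁, Y₂ and Z₂,
  -- which leaves the ratio of Z₀ to Z₁.
  edge₃-identity : ∀ x₀ x₃ y₀ y₁ y₃ z₀ z₁ Y₁ Y₂ Z₀ Z₁ Z₂ →
    Y₁ * z₀ + Y₂ * x₀ ≈ Z₁ * y₀ + Z₂ * x₀ →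
    Y₁ * z₁ ≈ Z₁ * y₁ →
    Y₂ * x₃ ≈ Z₀ + Z₁ * y₃ + Z₂ * x₃ →
    Z₁ * (y₃ * x₀ * z₁ - x₃ * y₀ * z₁ + x₃ * z₀ * y₁) ≈ - (Z₀ * (x₀ * z₁))
  edge₃-identity x₀ x₃ y₀ y₁ y₃ z₀ z₁ Y₁ Y₂ Z₀ Z₁ Z₂ e₀ e₁ e₃ = by-combination
    ((x₃ * z₁) ⊙ e₀ ⊕ (- (x₃ * z₀)) ⊙ e₁ ⊕ (- (x₀ * z₁)) ⊙ e₃)
    (solve 12 (λ x₀ x₃ y₀ y₁ y₃ z₀ z₁ Y₁ Y₂ Z₀ Z₁ Z₂ →
      Z₁ :* (y₃ :* x₀ :* z₁ :- x₃ :* y₀ :* z₁ :+ x₃ :* z₀ :* y₁)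
      := :- (Z₀ :* (x₀ :* z₁))
        :+ ((x₃ :* z₁) :* ((Y₁ :* z₀ :+ Y₂ :* x₀) :- (Z₁ :* y₀ :+ Z₂ :* x₀))
        :+ (:- (x₃ :* z₀)) :* (Y₁ :* z₁ :- Z₁ :* y₁)
        :+ (:- (x₀ :* z₁)) :* (Y₂ :* x₃ :- (Z₀ :+ Z₁ :* y₃ :+ Z₂ :* x₃))))
      refl x₀ x₃ y₀ y₁ y₃ z₀ z₁ Y₁ Y₂ Z₀ Z₁ Z₂)

  -- Cubes

  record Cube (P P₁ P₂ P₃ P₁₂ P₁₃ P₂₃ P₁₂₃ : Homogeneous) : Set where
    field
      corners : Independent (P ∷ P₁ ∷ P₂ ∷ P₃ ∷ [])
      f₁₂     : Face P P₁ P₂ P₁₂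
      f₁₃     : Face P P₁ P₃ P₁₃
      f₂₃     : Face P P₂ P₃ P₂₃
      g₁₂     : Face P₃ P₁₃ P₂₃ P₁₂₃
      g₁₃     : Face P₂ P₁₂ P₂₃ P₁₂₃
      g₂₃     : Face P₁ P₁₂ P₁₃ P₁₂₃

    -- Subscripts of lower-case coefficients name the corner that is multiplied, with 0 for P. Those
    -- of upper-case coefficients only give the position in the face relation.
    open Face f₂₃ public using ()
      renaming (a to x₀; b to x₂; c to x₃; a#0 to x₀#0; b#0 to x₂#0; c#0 to x₃#0; P₁₁≈ to P₂₃≈)
    open Face f₁₃ public using ()
      renaming (a to y₀; b to y₁; c to y₃; a#0 to y₀#0; c#0 to y₃#0; P₁₁≈ to P₁₃≈)
    open Face f₁₂ public using ()
      renaming (a to z₀; b to z₁; c to z₂; a#0 to z₀#0; b#0 to z₁#0; c#0 to z₂#0; P₁₁≈ to P₁₂≈)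
    open Face g₂₃ public using ()
      renaming (a to X₀; b to X₁; c to X₂; P₁₁≈ to P₁₂₃≈X)
    open Face g₁₃ public using ()
      renaming (a to Y₀; b to Y₁; c to Y₂; a#0 to Y₀#0; c#0 to Y₂#0; P₁₁≈ to P₁₂₃≈Y)
    open Face g₁₂ public using ()
      renaming (a to Z₀; b to Z₁; c to Z₂; b#0 to Z₁#0; c#0 to Z₂#0; P₁₁≈ to P₁₂₃≈Z)

    private
      -- Each of the three faces at P₁₂₃ gives its coordinates in the basis P, P₁, P₂, P₃ once the
      -- neighbours of P₁₂₃ are expanded.
      coordinates-X coordinates-Y coordinates-Z : Vector Carrier 4
      coordinates-X = X₁ * z₀ + X₂ * y₀ ∷ X₀ + X₁ * z₁ + X₂ * y₁ ∷ X₁ * z₂ ∷ X₂ * y₃ ∷ []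
      coordinates-Y = Y₁ * z₀ + Y₂ * x₀ ∷ Y₁ * z₁ ∷ Y₀ + Y₁ * z₂ + Y₂ * x₂ ∷ Y₂ * x₃ ∷ []
      coordinates-Z = Z₁ * y₀ + Z₂ * x₀ ∷ Z₁ * y₁ ∷ Z₂ * x₂ ∷ Z₀ + Z₁ * y₃ + Z₂ * x₃ ∷ []

      expand-X : ∀ s → P₁₂₃ s ≈ combination coordinates-X (P ∷ P₁ ∷ P₂ ∷ P₃ ∷ []) s
      expand-X s = begin
        P₁₂₃ s                                   ≈⟨ P₁₂₃≈X s ⟩
        X₀ * P₁ s + X₁ * P₁₂ s + X₂ * P₁₃ s      ≈⟨ +-cong (+-congˡ (*-congˡ (P₁₂≈ s))) (*-congˡ (P₁₃≈ s)) ⟩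
        _                                        ≈⟨ solve 13 (λ X₀ X₁ X₂ y₀ y₁ y₃ z₀ z₁ z₂ p p₁ p₂ p₃ →
          X₀ :* p₁ :+ X₁ :* (z₀ :* p :+ z₁ :* p₁ :+ z₂ :* p₂) :+ X₂ :* (y₀ :* p :+ y₁ :* p₁ :+ y₃ :* p₃)
          := (X₁ :* z₀ :+ X₂ :* y₀) :* p :+ ((X₀ :+ X₁ :* z₁ :+ X₂ :* y₁) :* p₁ :+ (X₁ :* z₂ :* p₂ :+ (X₂ :* y₃ :* p₃ :+ con 0ℤ))))
          refl X₀ X₁ X₂ y₀ y₁ y₃ z₀ z₁ z₂ (P s) (P₁ s) (P₂ s) (P₃ s) ⟩
        _                                        ∎

      expand-Y : ∀ s → P₁₂₃ s ≈ combination coordinates-Y (P ∷ P₁ ∷ P₂ ∷ P₃ ∷ []) s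
      expand-Y s = begin
        P₁₂₃ s                                   ≈⟨ P₁₂₃≈Y s ⟩
        Y₀ * P₂ s + Y₁ * P₁₂ s + Y₂ * P₂₃ s      ≈⟨ +-cong (+-congˡ (*-congˡ (P₁₂≈ s))) (*-congˡ (P₂₃≈ s)) ⟩
        _                                        ≈⟨ solve 13 (λ Y₀ Y₁ Y₂ x₀ x₂ x₃ z₀ z₁ z₂ p p₁ p₂ p₃ →
          Y₀ :* p₂ :+ Y₁ :* (z₀ :* p :+ z₁ :* p₁ :+ z₂ :* p₂) :+ Y₂ :* (x₀ :* p :+ x₂ :* p₂ :+ x₃ :* p₃)
          := (Y₁ :* z₀ :+ Y₂ :* x₀) :* p :+ (Y₁ :* z₁ :* p₁ :+ ((Y₀ :+ Y₁ :* z₂ :+ Y₂ :* x₂) :* p₂ :+ (Y₂ :* x₃ :* p₃ :+ con 0ℤ))))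
          refl Y₀ Y₁ Y₂ x₀ x₂ x₃ z₀ z₁ z₂ (P s) (P₁ s) (P₂ s) (P₃ s) ⟩
        _                                        ∎

      expand-Z : ∀ s → P₁₂₃ s ≈ combination coordinates-Z (P ∷ P₁ ∷ P₂ ∷ P₃ ∷ []) s
      expand-Z s = begin
        P₁₂₃ s                                   ≈⟨ P₁₂₃≈Z s ⟩
        Z₀ * P₃ s + Z₁ * P₁₃ s + Z₂ * P₂₃ s      ≈⟨ +-cong (+-congˡ (*-congˡ (P₁₃≈ s))) (*-congˡ (P₂₃≈ s)) ⟩
        _                                        ≈⟨ solve 13 (λ Z₀ Z₁ Z₂ x₀ x₂ x₃ y₀ y₁ y₃ p p₁ p₂ p₃ →
          Z₀ :* p₃ :+ Z₁ :* (y₀ :* p :+ y₁ :* p₁ :+ y₃ :* p₃) :+ Z₂ :* (x₀ :* p :+ x₂ :* p₂ :+ x₃ :* p₃)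
          := (Z₁ :* y₀ :+ Z₂ :* x₀) :* p :+ (Z₁ :* y₁ :* p₁ :+ (Z₂ :* x₂ :* p₂ :+ ((Z₀ :+ Z₁ :* y₃ :+ Z₂ :* x₃) :* p₃ :+ con 0ℤ))))
          refl Z₀ Z₁ Z₂ x₀ x₂ x₃ y₀ y₁ y₃ (P s) (P₁ s) (P₂ s) (P₃ s) ⟩
        _                                        ∎

    X≈Y : ∀ r → coordinates-X r ≈ coordinates-Y r
    X≈Y = independent-injective (P ∷ P₁ ∷ P₂ ∷ P₃ ∷ []) corners coordinates-X coordinates-Y
      λ s → trans (sym (expand-X s)) (expand-Y s)

    Y≈Z : ∀ r → coordinates-Y r ≈ coordinates-Z r
    Y≈Z = independent-injective (P ∷ P₁ ∷ P₂ ∷ P₃ ∷ []) corners coordinates-Y coordinates-Z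
      λ s → trans (sym (expand-Y s)) (expand-Z s)

  -- Directions 2, 3, 1 take the places of 1, 2, 3. A face is swapped when its two directions come
  -- out in the opposite order.
  rotate : ∀ {P P₁ P₂ P₃ P₁₂ P₁₃ P₂₃ P₁₂₃} → Cube P P₁ P₂ P₃ P₁₂ P₁₃ P₂₃ P₁₂₃ → Cube P P₂ P₃ P₁ P₂₃ P₁₂ P₁₃ P₁₂₃
  rotate {P} {P₁} {P₂} {P₃} C = record
    { corners = λ x rel →
        let ≈0 = corners (x 0F ∷ x 3F ∷ x 1F ∷ x 2F ∷ []) λ s → trans
                   (solve 8 (λ x y z w p q r t → x :* p :+ (w :* t :+ (y :* q :+ (z :* r :+ con 0ℤ)))
                     := x :* p :+ (y :* q :+ (z :* r :+ (w :* t :+ con 0ℤ))))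
                      refl (x 0F) (x 1F) (x 2F) (x 3F) (P s) (P₂ s) (P₃ s) (P₁ s))
                   (rel s)
        in λ { 0F → ≈0 0F ; 1F → ≈0 2F ; 2F → ≈0 3F ; 3F → ≈0 1F }
    ; f₁₂ = f₂₃ ; f₁₃ = swap f₁₂ ; f₂₃ = swap f₁₃
    ; g₁₂ = g₂₃ ; g₁₃ = swap g₁₂ ; g₂₃ = swap g₁₃
    }
    where open Cube C

  join : Homogeneous → Homogeneous → Subspace
  join E E′ = Span (E ∷ E′ ∷ [])

  module _ {P P₁ P₂ P₃ P₁₂ P₁₃ P₂₃ P₁₂₃} (C : Cube P P₁ P₂ P₃ P₁₂ P₁₃ P₂₃ P₁₂₃) where
    open Cube C

    -- The two lines meeting each edge are listed in the cyclic order of the directions, so rotating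
    -- the cube merely permutes the three fields.
    record EdgeWeights (A B C : Carrier) : Set where
      field
        isA : IsWeight P (join P P₁ ∩ join P₂ P₁₂) P₁ (join P P₁ ∩ join P₃ P₁₃) A
        isB : IsWeight P (join P P₂ ∩ join P₃ P₂₃) P₂ (join P P₂ ∩ join P₁ P₁₂) B
        isC : IsWeight P (join P P₃ ∩ join P₁ P₁₃) P₃ (join P P₃ ∩ join P₂ P₂₃) C

      A≈ : A * (z₁ * y₀) ≈ - (z₀ * y₁)
      A≈ = weight (near-independent f₁₂) (near-meets f₁₂) (near-meets f₁₃) isA

      B≈ : B * (x₂ * z₀) ≈ - (x₀ * z₂)
      B≈ = weight (near-independent f₂₃) (near-meets f₂₃) (near-meets (swap f₁₂)) isB

      C≈ : C * (y₃ * x₀) ≈ - (y₀ * x₃)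
      C≈ = weight (near-independent (swap f₁₃)) (near-meets (swap f₁₃)) (near-meets (swap f₂₃)) isC

    module _ {A B C} (W : EdgeWeights A B C) where
      open EdgeWeights W

      far-edge-weight : ∀ {T} →
        IsWeight P₂₃ (join P₂₃ P₁₂₃ ∩ join P₂ P₁₂) P₁₂₃ (join P₂₃ P₁₂₃ ∩ join P₃ P₁₃) T →
        T * B * (1# + C + C * A) ≈ 1# + A + B * A
      far-edge-weight {T} isT = *-cancelˡ m#0 (begin
        m * (T * B * (1# + C + C * A))
          ≈⟨ solve 11 (λ x₀ x₂ y₀ y₃ z₀ z₁ Z₂ T A B C →
               Z₂ :* y₃ :* z₀ :* z₁ :* y₀ :* x₂ :* x₀ :* (T :* B :* (con 1ℤ :+ C :+ C :* A))
               := (:- (T :* ((:- con 1ℤ) :* Z₂))) :* (B :* (x₂ :* z₀)) :* ((con 1ℤ :+ C :+ C :* A) :* (y₃ :* x₀ :* z₁)) :* y₀)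
             refl x₀ x₂ y₀ y₃ z₀ z₁ Z₂ T A B C ⟩
        - (T * (- 1# * Z₂)) * (B * (x₂ * z₀)) * ((1# + C + C * A) * (y₃ * x₀ * z₁)) * y₀
          ≈⟨ *-congʳ (*-cong (*-cong (-‿cong T≈) B≈) (denominator x₀ x₃ y₀ y₁ y₃ z₀ z₁ A C A≈ C≈)) ⟩
        - (- (Y₂ * - 1#)) * (- (x₀ * z₂)) * G * y₀
          ≈⟨ solve 5 (λ x₀ y₀ z₂ Y₂ G → (:- (:- (Y₂ :* :- con 1ℤ))) :* (:- (x₀ :* z₂)) :* G :* y₀ := x₀ :* (z₂ :* y₀ :* Y₂ :* G))
             refl x₀ y₀ z₂ Y₂ G ⟩
        x₀ * (z₂ * y₀ * Y₂ * G)
          ≈⟨ *-congˡ (far-edge-identity x₀ x₂ x₃ y₀ y₁ y₃ z₀ z₁ z₂ X₁ X₂ Y₁ Y₂ Z₁ Z₂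
                (X≈Y 0F) (Y≈Z 0F) (Y≈Z 1F) (trans (X≈Y 2F) (Y≈Z 2F)) (X≈Y 3F)) ⟨
        x₀ * (y₃ * z₀ * Z₂ * F)
          ≈⟨ *-congˡ (*-congˡ (numerator x₀ x₂ y₀ y₁ z₀ z₁ z₂ A B A≈ B≈)) ⟨
        x₀ * (y₃ * z₀ * Z₂ * ((1# + A + B * A) * (z₁ * y₀ * x₂)))
          ≈⟨ solve 8 (λ x₀ x₂ y₀ y₃ z₀ z₁ Z₂ N →
               x₀ :* (y₃ :* z₀ :* Z₂ :* (N :* (z₁ :* y₀ :* x₂))) := Z₂ :* y₃ :* z₀ :* z₁ :* y₀ :* x₂ :* x₀ :* N)
             refl x₀ x₂ y₀ y₃ z₀ z₁ Z₂ (1# + A + B * A) ⟩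
        m * (1# + A + B * A) ∎)
        where
        F = z₁ * y₀ * x₂ - z₀ * y₁ * x₂ + x₀ * z₂ * y₁
        G = y₃ * x₀ * z₁ - x₃ * y₀ * z₁ + x₃ * z₀ * y₁
        -- The product of the denominators of T, A, B and C.
        m = Z₂ * y₃ * z₀ * z₁ * y₀ * x₂ * x₀
        m#0 : m # 0#
        m#0 = Z₂#0 ⊗ y₃#0 ⊗ z₀#0 ⊗ z₁#0 ⊗ y₀#0 ⊗ x₂#0 ⊗ x₀#0
        -- The edge P₂₃P₁₂₃ is the far edge of both `g₁₃` and `g₁₂`, which gives T = -Y₂/Z₂.
        T≈ : T * (- 1# * Z₂) ≈ - (Y₂ * - 1#)
        T≈ = weight (far-independent g₁₃) (far-meets g₁₃) (far-meets g₁₂) isT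

      -- On the edge P₂P₁₂ the lines PP₁ and P₂₃P₁₂₃ cut out the points (z₂ : -1) and (Y₀ : Y₁). Up
      -- to sign, the ratio z₂Y₁/Y₀ compares them, and it depends on A and B alone.
      edge₂-ratio : z₂ * Y₁ * (1# + A + A * B) ≈ - (Y₀ * (A * B))
      edge₂-ratio = *-cancelˡ (x₂#0 ⊗ z₁#0 ⊗ y₀#0 ⊗ z₀#0) (begin
        x₂ * z₁ * y₀ * z₀ * (z₂ * Y₁ * (1# + A + A * B))
          ≈⟨ solve 8 (λ x₂ y₀ z₀ z₁ z₂ Y₁ A B →
               x₂ :* z₁ :* y₀ :* z₀ :* (z₂ :* Y₁ :* (con 1ℤ :+ A :+ A :* B))
               := z₀ :* z₂ :* (Y₁ :* ((con 1ℤ :+ A :+ B :* A) :* (z₁ :* y₀ :* x₂))))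
             refl x₂ y₀ z₀ z₁ z₂ Y₁ A B ⟩
        z₀ * z₂ * (Y₁ * ((1# + A + B * A) * (z₁ * y₀ * x₂)))
          ≈⟨ *-congˡ (*-congˡ (numerator x₀ x₂ y₀ y₁ z₀ z₁ z₂ A B A≈ B≈)) ⟩
        _ ≈⟨ *-congˡ (edge₂-identity x₀ x₂ y₀ y₁ z₀ z₁ z₂ Y₀ Y₁ Y₂ Z₁ Z₂ (Y≈Z 0F) (Y≈Z 1F) (Y≈Z 2F)) ⟩
        z₀ * z₂ * - (Y₀ * (x₀ * y₁))
          ≈⟨ solve 5 (λ x₀ y₁ z₀ z₂ Y₀ → z₀ :* z₂ :* (:- (Y₀ :* (x₀ :* y₁))) := (:- Y₀) :* ((:- (z₀ :* y₁)) :* (:- (x₀ :* z₂))))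
             refl x₀ y₁ z₀ z₂ Y₀ ⟩
        - Y₀ * (- (z₀ * y₁) * - (x₀ * z₂))
          ≈⟨ *-congˡ (*-cong A≈ B≈) ⟨
        - Y₀ * (A * (z₁ * y₀) * (B * (x₂ * z₀)))
          ≈⟨ solve 7 (λ x₂ y₀ z₀ z₁ Y₀ A B → (:- Y₀) :* (A :* (z₁ :* y₀) :* (B :* (x₂ :* z₀))) := x₂ :* z₁ :* y₀ :* z₀ :* (:- (Y₀ :* (A :* B))))
             refl x₂ y₀ z₀ z₁ Y₀ A B ⟩
        x₂ * z₁ * y₀ * z₀ * - (Y₀ * (A * B)) ∎)

      -- The same comparison on the edge P₃P₁₃, where PP₁ and P₂₃P₁₂₃ cut out (y₃ : -1) and (Z₀ :
      -- Z₁).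
      edge₃-ratio : y₃ * Z₁ * (1# + C + C * A) ≈ - Z₀
      edge₃-ratio = *-cancelˡ (x₀#0 ⊗ z₁#0) (begin
        x₀ * z₁ * (y₃ * Z₁ * (1# + C + C * A))
          ≈⟨ solve 5 (λ x₀ y₃ z₁ Z₁ D → x₀ :* z₁ :* (y₃ :* Z₁ :* D) := Z₁ :* (D :* (y₃ :* x₀ :* z₁)))
             refl x₀ y₃ z₁ Z₁ (1# + C + C * A) ⟩
        Z₁ * ((1# + C + C * A) * (y₃ * x₀ * z₁))
          ≈⟨ *-congˡ (denominator x₀ x₃ y₀ y₁ y₃ z₀ z₁ A C A≈ C≈) ⟩
        _ ≈⟨ edge₃-identity x₀ x₃ y₀ y₁ y₃ z₀ z₁ Y₁ Y₂ Z₀ Z₁ Z₂ (Y≈Z 0F) (Y≈Z 1F) (Y≈Z 3F) ⟩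
        - (Z₀ * (x₀ * z₁))
          ≈⟨ solve 3 (λ x₀ z₁ Z₀ → :- (Z₀ :* (x₀ :* z₁)) := x₀ :* z₁ :* (:- Z₀)) refl x₀ z₁ Z₀ ⟩
        x₀ * z₁ * - Z₀ ∎)

  rotate-weights : ∀ {P P₁ P₂ P₃ P₁₂ P₁₃ P₂₃ P₁₂₃} {C : Cube P P₁ P₂ P₃ P₁₂ P₁₃ P₂₃ P₁₂₃} {w₁ w₂ w₃} →
                   EdgeWeights C w₁ w₂ w₃ → EdgeWeights (rotate C) w₂ w₃ w₁
  rotate-weights W = record { isA = isB ; isB = isC ; isC = isA }
    where open EdgeWeights W

  -- C and D share the edge from P to P₁, above C in direction 2 and above D in direction 3.
  shared-edge-weights :
    ∀ {P P₁ C₀ C₁ C₃ C₁₃ P₃ P₁₃ D₀ D₁ D₂ D₁₂ P₂ P₁₂ A B A′ C′ E T w w′}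
    {C : Cube C₀ C₁ P C₃ P₁ C₁₃ P₃ P₁₃} {D : Cube D₀ D₁ D₂ P D₁₂ P₁ P₂ P₁₂} →
    EdgeWeights C A B w → EdgeWeights D A′ w′ C′ →
    IsWeight P (join P P₁ ∩ join P₂ P₁₂) P₁ (join P P₁ ∩ join P₃ P₁₃) E →
    IsWeight P (join P P₁ ∩ join D₀ D₁) P₁ (join P P₁ ∩ join C₀ C₁) T →
    E * (1# + A + A * B) ≈ T * A * B * (1# + C′ + C′ * A′)
  shared-edge-weights {A = A} {B} {A′} {C′} {E} {T} {C = C} {D} W W′ isE isT =
    *-cancelˡ (D.Z₁#0 ⊗ C.Y₀#0 ⊗ C.z₂#0) (begin
      D.Z₁ * C.Y₀ * C.z₂ * (E * (1# + A + A * B))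
        ≈⟨ solve 5 (λ Z₁ Y₀ z₂ E N → Z₁ :* Y₀ :* z₂ :* (E :* N) := E :* (Z₁ :* Y₀) :* (z₂ :* N))
           refl D.Z₁ C.Y₀ C.z₂ E (1# + A + A * B) ⟩
      E * (D.Z₁ * C.Y₀) * (C.z₂ * (1# + A + A * B))
        ≈⟨ *-congʳ E≈ ⟩
      - (D.Z₀ * C.Y₁) * (C.z₂ * (1# + A + A * B))
        ≈⟨ solve 4 (λ Z₀ Y₁ z₂ N → :- (Z₀ :* Y₁) :* (z₂ :* N) := :- (Z₀ :* (z₂ :* Y₁ :* N)))
           refl D.Z₀ C.Y₁ C.z₂ (1# + A + A * B) ⟩
      - (D.Z₀ * (C.z₂ * C.Y₁ * (1# + A + A * B)))
        ≈⟨ -‿cong (*-congˡ (edge₂-ratio C W)) ⟩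
      - (D.Z₀ * - (C.Y₀ * (A * B)))
        ≈⟨ solve 3 (λ Z₀ Y₀ t → :- (Z₀ :* :- (Y₀ :* t)) := :- (:- Z₀) :* (Y₀ :* t)) refl D.Z₀ C.Y₀ (A * B) ⟩
      - (- D.Z₀) * (C.Y₀ * (A * B))
        ≈⟨ *-congʳ (-‿cong (edge₃-ratio D W′)) ⟨
      - (D.y₃ * D.Z₁ * (1# + C′ + C′ * A′)) * (C.Y₀ * (A * B))
        ≈⟨ solve 5 (λ y₃ Z₁ M Y₀ t → :- (y₃ :* Z₁ :* M) :* (Y₀ :* t) := :- (:- (y₃ :* (:- con 1ℤ))) :* (Z₁ :* M :* Y₀ :* t))
           refl D.y₃ D.Z₁ (1# + C′ + C′ * A′) C.Y₀ (A * B) ⟩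
      - (- (D.y₃ * - 1#)) * (D.Z₁ * (1# + C′ + C′ * A′) * C.Y₀ * (A * B))
        ≈⟨ *-congʳ (-‿cong T≈) ⟨
      - (T * (- 1# * C.z₂)) * (D.Z₁ * (1# + C′ + C′ * A′) * C.Y₀ * (A * B))
        ≈⟨ solve 7 (λ Z₁ Y₀ z₂ T A B M → :- (T :* ((:- con 1ℤ) :* z₂)) :* (Z₁ :* M :* Y₀ :* (A :* B))
                                         := Z₁ :* Y₀ :* z₂ :* (T :* A :* B :* M))
           refl D.Z₁ C.Y₀ C.z₂ T A B (1# + C′ + C′ * A′) ⟩
      D.Z₁ * C.Y₀ * C.z₂ * (T * A * B * (1# + C′ + C′ * A′)) ∎)
    where
    module C = Cube C
    module D = Cube D
    -- The shared edge is P₂P₁₂ for `C` and P₃P₁₃ for `D`. With T = -y₃/z₂ from `T≈`, the quotient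
    -- E/T is z₂Y₁/Y₀ of `C` times Z₀/(y₃Z₁) of `D`, which the two edge ratios evaluate.
    E≈ : E * (D.Z₁ * C.Y₀) ≈ - (D.Z₀ * C.Y₁)
    E≈ = weight (near-independent C.g₁₃) (near-meets D.g₁₂) (near-meets C.g₁₃) isE
    T≈ : T * (- 1# * C.z₂) ≈ - (D.y₃ * - 1#)
    T≈ = weight (far-independent C.f₁₂) (far-meets D.f₁₃) (far-meets C.f₁₂) isT

  -- Nets

  -- Coplanarity makes the four vectors dependent and non-collinearity makes every three of them
  -- independent, so they form a circuit, and its relation can be solved for P₁₁.
  face : ∀ {P₀₀ P₁₀ P₀₁ P₁₁} → let Ps = P₀₀ ∷ P₁₀ ∷ P₀₁ ∷ P₁₁ ∷ [] in
         Coplanar Ps →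
         (∀ r s t → r ≢ s → s ≢ t → r ≢ t → ¬ Collinear (Ps r ∷ Ps s ∷ Ps t ∷ [])) →
         ¬ ¬ Face P₀₀ P₁₀ P₀₁ P₁₁
  face {P₀₀} {P₁₀} {P₀₁} {P₁₁} coplanar noncollinear = ¬¬-map
    (λ (c , c#0 , rel) →
      let k    = c 3F ⁻¹⟨ c#0 3F ⟩
          ck≈1 = ⁻¹-inverse (c#0 3F)
          -k#0 = invertible⇒#0 {x = - k} {y = - c 3F} (trans (solve 2 (λ c k → :- k :* :- c := c :* k) refl (c 3F) k) ck≈1)
      in record
        { a = c 0F * - k ; b = c 1F * - k ; c = c 2F * - k
        ; a#0 = c#0 0F ⊗ -k#0
        ; b#0 = c#0 1F ⊗ -k#0
        ; c#0 = c#0 2F ⊗ -k#0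
        ; independent = ¬spanned⇒independent _ (noncollinear 0F 1F 2F (λ ()) (λ ()) (λ ()))
        ; P₁₁≈ = λ s → by-combination (k ⊙ rel s ⊕ (- P₁₁ s) ⊙ ck≈1)
            (solve 9 (λ a b c d k p q r t → t := a :* :- k :* p :+ b :* :- k :* q :+ c :* :- k :* r
              :+ (k :* (a :* p :+ (b :* q :+ (c :* r :+ (d :* t :+ con 0ℤ))) :- con 0ℤ) :+ :- t :* (d :* k :- con 1ℤ)))
              refl (c 0F) (c 1F) (c 2F) (c 3F) k (P₀₀ s) (P₁₀ s) (P₀₁ s) (P₁₁ s))
        })
    (circuit Ps coplanar λ r → ¬spanned⇒independent (removeAt Ps r) λ (us , ∈us) →
      noncollinear (punchIn r 0F) (punchIn r 1F) (punchIn r 2F)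
        (λ eq → contradiction (punchIn-injective r 0F 1F eq) λ ())
        (λ eq → contradiction (punchIn-injective r 1F 2F eq) λ ())
        (λ eq → contradiction (punchIn-injective r 0F 2F eq) λ ())
        -- The points left by `removeAt` agree with the listed triple only index by index.
        (us , λ { 0F → ∈us 0F ; 1F → ∈us 1F ; 2F → ∈us 2F }))
    where
    Ps = P₀₀ ∷ P₁₀ ∷ P₀₁ ∷ P₁₁ ∷ []

  ≈-inverse-quotient : ∀ {T A B C} (B#0 : B # 0#) (D#0 : 1# + C + C * A # 0#) →
    T * B * (1# + C + C * A) ≈ 1# + A + B * A →
    T ≈ B ⁻¹⟨ B#0 ⟩ * ((1# + A + B * A) / (1# + C + C * A) ⟨ D#0 ⟩)
  ≈-inverse-quotient {T} {A} {B} {C} B#0 D#0 TBD≈N = begin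
    T                                   ≈⟨ solve 1 (λ T → T := T :* (con 1ℤ :* con 1ℤ)) refl T ⟩
    T * (1# * 1#)                       ≈⟨ *-congˡ (*-cong (⁻¹-inverse B#0) (⁻¹-inverse D#0)) ⟨
    T * ((B * B⁻¹) * (D * D⁻¹))         ≈⟨ solve 5 (λ T B I D J → T :* ((B :* I) :* (D :* J)) := I :* (T :* B :* D :* J))
                                             refl T B B⁻¹ D D⁻¹ ⟩
    B⁻¹ * (T * B * D * D⁻¹)             ≈⟨ *-congˡ (*-congʳ TBD≈N) ⟩
    B⁻¹ * ((1# + A + B * A) * D⁻¹)      ∎
    where
    D = 1# + C + C * A
    B⁻¹ = B ⁻¹⟨ B#0 ⟩
    D⁻¹ = D ⁻¹⟨ D#0 ⟩

  ≈-quotient : ∀ {E N M X} (N#0 : N # 0#) → E * N ≈ X * M → E ≈ X * (M / N ⟨ N#0 ⟩)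
  ≈-quotient {E} {N} {M} {X} N#0 EN≈XM = begin
    E                      ≈⟨ *-identityʳ E ⟨
    E * 1#                 ≈⟨ *-congˡ (⁻¹-inverse N#0) ⟨
    E * (N * N ⁻¹⟨ N#0 ⟩)  ≈⟨ *-assoc _ _ _ ⟨
    E * N * N ⁻¹⟨ N#0 ⟩    ≈⟨ *-congʳ EN≈XM ⟩
    X * M * N ⁻¹⟨ N#0 ⟩    ≈⟨ *-assoc _ _ _ ⟩
    X * (M * N ⁻¹⟨ N#0 ⟩)  ∎

  module Recurrences (Q : Net) (isQNet : IsQNet Q) (W : Weights Q) (G : IsGeneric Q W) where
    open Weights W
    open IsGeneric G

    private
      P : ℤ³ → Homogeneous
      P = ⟦ Q ⟧

    net-face : ∀ u a b → a ≢ b → ¬ ¬ Face (P u) (P (u +e a)) (P (u +e b)) (P (u +e a +e b))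
    net-face u a b a≢b = face (isQNet u a b a≢b) (noThreeCollinear u a b a≢b)

    CubeAt : ℤ³ → Set
    CubeAt u = Cube (P u) (P (u +e 0F)) (P (u +e 1F)) (P (u +e 2F))
                    (P (u +e 0F +e 1F)) (P (u +e 0F +e 2F)) (P (u +e 1F +e 2F)) (P (u +e 0F +e 1F +e 2F))

    cube : ∀ u → ¬ ¬ CubeAt u
    cube u none =
      net-face u 0F 1F (λ ()) λ f₁₂ → net-face u 0F 2F (λ ()) λ f₁₃ → net-face u 1F 2F (λ ()) λ f₂₃ →
      -- Steps in different directions change different coordinates, so they commute by computation
      -- and the far faces have the vertices required by `CubeAt`.
      net-face (u +e 2F) 0F 1F (λ ()) λ g₁₂ → net-face (u +e 1F) 0F 2F (λ ()) λ g₁₃ →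
      net-face (u +e 0F) 1F 2F (λ ()) λ g₂₃ →
      none record
        { corners = ¬spanned⇒independent _ (cornersNotCoplanar u)
        ; f₁₂ = f₁₂ ; f₁₃ = f₁₃ ; f₂₃ = f₂₃ ; g₁₂ = g₁₂ ; g₁₃ = g₁₃ ; g₂₃ = g₂₃
        }

    edge-weights : ∀ u (C : CubeAt u) → EdgeWeights C (Yˣ u) (Yʸ u) (Yᶻ u)
    edge-weights (i , j , k) C = record { isA = isYˣ i j k ; isB = isYʸ i j k ; isC = isYᶻ i j k }

    -- The edge of this variable is the far edge P₂₃P₁₂₃ of the cube at `u`. The cube exists only up
    -- to double negation, so stability is applied to the equation before dividing.
    Ỹˣ-recurrence : ∀ i j k → let u = i , j , k in
      Ỹˣ (i , j +ᶻ 1ℤ , k +ᶻ 1ℤ)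
        ≈ Yʸ u ⁻¹⟨ Yʸ#0 u ⟩ * ((1# + Yˣ u + Yʸ u * Yˣ u) / (1# + Yᶻ u + Yᶻ u * Yˣ u) ⟨ 1+Yᶻ+YᶻYˣ#0 u ⟩)
    Ỹˣ-recurrence i j k = ≈-inverse-quotient (Yʸ#0 u) (1+Yᶻ+YᶻYˣ#0 u)
      (≈-stable (¬¬-map (λ C → far-edge-weight C (edge-weights u C) isT) (cube u)))
      where
      u = i , j , k
      v = i , j +ᶻ 1ℤ , k +ᶻ 1ℤ
      w = i +ᶻ 1ℤ , j +ᶻ 1ℤ , k +ᶻ 1ℤ
      -- The indices (j + 1) - 1 and (k + 1) - 1 do not reduce, so the weight is transported to the
      -- edges of the cube.
      isT = ≡.subst₂ (λ j′ k′ → IsWeight (P v) (Qˣ Q v ∩ Qˣ Q (i , j +ᶻ 1ℤ , k′)) (P w) (Qˣ Q v ∩ Qˣ Q (i , j′ , k +ᶻ 1ℤ)) (Ỹˣ v))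
              ([i+1]-1≡i j) ([i+1]-1≡i k) (isỸˣ i (j +ᶻ 1ℤ) (k +ᶻ 1ℤ))

    Ỹʸ-recurrence : ∀ i j k → let u = i , j , k in
      Ỹʸ (i +ᶻ 1ℤ , j , k +ᶻ 1ℤ)
        ≈ Yᶻ u ⁻¹⟨ Yᶻ#0 u ⟩ * ((1# + Yʸ u + Yᶻ u * Yʸ u) / (1# + Yˣ u + Yˣ u * Yʸ u) ⟨ 1+Yˣ+YˣYʸ#0 u ⟩)
    Ỹʸ-recurrence i j k = ≈-inverse-quotient (Yᶻ#0 u) (1+Yˣ+YˣYʸ#0 u)
      -- After one rotation the weights A, B, C of the cube are `Yʸ`, `Yᶻ`, `Yˣ` at `u`.
      (≈-stable (¬¬-map (λ C → far-edge-weight (rotate C) (rotate-weights (edge-weights u C)) isT) (cube u)))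
      where
      u = i , j , k
      v = i +ᶻ 1ℤ , j , k +ᶻ 1ℤ
      w = i +ᶻ 1ℤ , j +ᶻ 1ℤ , k +ᶻ 1ℤ
      isT = ≡.subst₂ (λ i′ k′ → IsWeight (P v) (Qʸ Q v ∩ Qʸ Q (i′ , j , k +ᶻ 1ℤ)) (P w) (Qʸ Q v ∩ Qʸ Q (i +ᶻ 1ℤ , j , k′)) (Ỹʸ v))
              ([i+1]-1≡i i) ([i+1]-1≡i k) (isỸʸ (i +ᶻ 1ℤ) j (k +ᶻ 1ℤ))

    Ỹᶻ-recurrence : ∀ i j k → let u = i , j , k in
      Ỹᶻ (i +ᶻ 1ℤ , j +ᶻ 1ℤ , k)
        ≈ Yˣ u ⁻¹⟨ Yˣ#0 u ⟩ * ((1# + Yᶻ u + Yˣ u * Yᶻ u) / (1# + Yʸ u + Yʸ u * Yᶻ u) ⟨ 1+Yʸ+YʸYᶻ#0 u ⟩)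
    Ỹᶻ-recurrence i j k = ≈-inverse-quotient (Yˣ#0 u) (1+Yʸ+YʸYᶻ#0 u)
      (≈-stable (¬¬-map (λ C → far-edge-weight (rotate (rotate C)) (rotate-weights (rotate-weights (edge-weights u C))) isT)
                         (cube u)))
      where
      u = i , j , k
      v = i +ᶻ 1ℤ , j +ᶻ 1ℤ , k
      w = i +ᶻ 1ℤ , j +ᶻ 1ℤ , k +ᶻ 1ℤ
      isT = ≡.subst₂ (λ i′ j′ → IsWeight (P v) (Qᶻ Q v ∩ Qᶻ Q (i +ᶻ 1ℤ , j′ , k)) (P w) (Qᶻ Q v ∩ Qᶻ Q (i′ , j +ᶻ 1ℤ , k)) (Ỹᶻ v))
              ([i+1]-1≡i i) ([i+1]-1≡i j) (isỸᶻ (i +ᶻ 1ℤ) (j +ᶻ 1ℤ) k)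

    -- The cubes at `v` and `w` share the x-edge at (i, j, k): it is P₂P₁₂ in the first and P₃P₁₃ in
    -- the second.
    Yˣ-recurrence : ∀ i j k → let v = i , j -ᶻ 1ℤ , k; w = i , j , k -ᶻ 1ℤ in
      Yˣ (i , j , k) ≈ Ỹˣ (i , j , k) * Yˣ v * Yʸ v
        * ((1# + Yᶻ w + Yᶻ w * Yˣ w) / (1# + Yˣ v + Yˣ v * Yʸ v) ⟨ 1+Yˣ+YˣYʸ#0 v ⟩)
    Yˣ-recurrence i j k = from (j -ᶻ 1ℤ) (k -ᶻ 1ℤ) ([i-1]+1≡i j) ([i-1]+1≡i k) (isỸˣ i j k)
      where
      -- The predecessors j - 1 and k - 1 are replaced by variables. Matching on the equations then
      -- makes the two cubes share the edge literally, without transport.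
      from : ∀ {j k} j′ k′ → j′ +ᶻ 1ℤ ≡ j → k′ +ᶻ 1ℤ ≡ k → let v = i , j′ , k; w = i , j , k′ in
        IsWeight (P (i , j , k)) (Qˣ Q (i , j , k) ∩ Qˣ Q w) (P (i +ᶻ 1ℤ , j , k)) (Qˣ Q (i , j , k) ∩ Qˣ Q v) (Ỹˣ (i , j , k)) →
        Yˣ (i , j , k) ≈ Ỹˣ (i , j , k) * Yˣ v * Yʸ v
          * ((1# + Yᶻ w + Yᶻ w * Yˣ w) / (1# + Yˣ v + Yˣ v * Yʸ v) ⟨ 1+Yˣ+YˣYʸ#0 v ⟩)
      from j′ k′ ≡.refl ≡.refl isT = ≈-quotient (1+Yˣ+YˣYʸ#0 v) (≈-stable λ ¬eq → cube v λ C → cube w λ D →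
        ¬eq (shared-edge-weights (edge-weights v C) (edge-weights w D) (isYˣ i (j′ +ᶻ 1ℤ) (k′ +ᶻ 1ℤ)) isT))
        where
        v = i , j′ , k′ +ᶻ 1ℤ
        w = i , j′ +ᶻ 1ℤ , k′

    Yʸ-recurrence : ∀ i j k → let v = i , j , k -ᶻ 1ℤ; w = i -ᶻ 1ℤ , j , k in
      Yʸ (i , j , k) ≈ Ỹʸ (i , j , k) * Yʸ v * Yᶻ v
        * ((1# + Yˣ w + Yˣ w * Yʸ w) / (1# + Yʸ v + Yʸ v * Yᶻ v) ⟨ 1+Yʸ+YʸYᶻ#0 v ⟩)
    Yʸ-recurrence i j k = from (k -ᶻ 1ℤ) (i -ᶻ 1ℤ) ([i-1]+1≡i k) ([i-1]+1≡i i) (isỸʸ i j k)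
      where
      from : ∀ {k i} k′ i′ → k′ +ᶻ 1ℤ ≡ k → i′ +ᶻ 1ℤ ≡ i → let v = i , j , k′; w = i′ , j , k in
        IsWeight (P (i , j , k)) (Qʸ Q (i , j , k) ∩ Qʸ Q w) (P (i , j +ᶻ 1ℤ , k)) (Qʸ Q (i , j , k) ∩ Qʸ Q v) (Ỹʸ (i , j , k)) →
        Yʸ (i , j , k) ≈ Ỹʸ (i , j , k) * Yʸ v * Yᶻ v
          * ((1# + Yˣ w + Yˣ w * Yʸ w) / (1# + Yʸ v + Yʸ v * Yᶻ v) ⟨ 1+Yʸ+YʸYᶻ#0 v ⟩)
      from k′ i′ ≡.refl ≡.refl isT = ≈-quotient (1+Yʸ+YʸYᶻ#0 v) (≈-stable λ ¬eq → cube v λ C → cube w λ D →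
        -- Rotating both cubes once makes the y-edge their first direction, with `v` below it in
        -- direction z and `w` below it in direction x.
        ¬eq (shared-edge-weights (rotate-weights (edge-weights v C)) (rotate-weights (edge-weights w D))
               (isYʸ (i′ +ᶻ 1ℤ) j (k′ +ᶻ 1ℤ)) isT))
        where
        v = i′ +ᶻ 1ℤ , j , k′
        w = i′ , j , k′ +ᶻ 1ℤ

    Yᶻ-recurrence : ∀ i j k → let v = i -ᶻ 1ℤ , j , k; w = i , j -ᶻ 1ℤ , k in
      Yᶻ (i , j , k) ≈ Ỹᶻ (i , j , k) * Yᶻ v * Yˣ v
        * ((1# + Yʸ w + Yʸ w * Yᶻ w) / (1# + Yᶻ v + Yᶻ v * Yˣ v) ⟨ 1+Yᶻ+YᶻYˣ#0 v ⟩)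
    Yᶻ-recurrence i j k = from (i -ᶻ 1ℤ) (j -ᶻ 1ℤ) ([i-1]+1≡i i) ([i-1]+1≡i j) (isỸᶻ i j k)
      where
      from : ∀ {i j} i′ j′ → i′ +ᶻ 1ℤ ≡ i → j′ +ᶻ 1ℤ ≡ j → let v = i′ , j , k; w = i , j′ , k in
        IsWeight (P (i , j , k)) (Qᶻ Q (i , j , k) ∩ Qᶻ Q w) (P (i , j , k +ᶻ 1ℤ)) (Qᶻ Q (i , j , k) ∩ Qᶻ Q v) (Ỹᶻ (i , j , k)) →
        Yᶻ (i , j , k) ≈ Ỹᶻ (i , j , k) * Yᶻ v * Yˣ v
          * ((1# + Yʸ w + Yʸ w * Yᶻ w) / (1# + Yᶻ v + Yᶻ v * Yˣ v) ⟨ 1+Yᶻ+YᶻYˣ#0 v ⟩)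
      from i′ j′ ≡.refl ≡.refl isT = ≈-quotient (1+Yᶻ+YᶻYˣ#0 v) (≈-stable λ ¬eq → cube v λ C → cube w λ D →
        ¬eq (shared-edge-weights (rotate-weights (rotate-weights (edge-weights v C)))
               (rotate-weights (rotate-weights (edge-weights w D)))
               (isYᶻ (i′ +ᶻ 1ℤ) (j′ +ᶻ 1ℤ) k) isT))
        where
        v = i′ , j′ +ᶻ 1ℤ , k
        w = i′ +ᶻ 1ℤ , j′ , k

-- The recurrences over the real numbers.

open import Defs

proposition4p12 :
  (Q : Net) → IsQNet Q → (W : Weights Q) → (G : IsGeneric Q W) →
  (t i j k : ℤ) → i +ᶻ j +ᶻ k ≡ t →
  let open Weights W
      open IsGeneric G
  in
  (  Ỹˣ (i , j +ᶻ 1ℤ , k +ᶻ 1ℤ)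
     ≈ Yʸ (i , j , k) ⁻¹⟨ Yʸ#0 (i , j , k) ⟩
       * ((1# + Yˣ (i , j , k) + Yʸ (i , j , k) * Yˣ (i , j , k))
          / (1# + Yᶻ (i , j , k) + Yᶻ (i , j , k) * Yˣ (i , j , k))
            ⟨ 1+Yᶻ+YᶻYˣ#0 (i , j , k) ⟩)) ×
  (  Yˣ (i +ᶻ 1ℤ , j , k)
     ≈ Ỹˣ (i +ᶻ 1ℤ , j , k) * Yˣ (i +ᶻ 1ℤ , j -ᶻ 1ℤ , k) * Yʸ (i +ᶻ 1ℤ , j -ᶻ 1ℤ , k)
       * ((1# + Yᶻ (i +ᶻ 1ℤ , j , k -ᶻ 1ℤ) + Yᶻ (i +ᶻ 1ℤ , j , k -ᶻ 1ℤ) * Yˣ (i +ᶻ 1ℤ , j , k -ᶻ 1ℤ))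
          / (1# + Yˣ (i +ᶻ 1ℤ , j -ᶻ 1ℤ , k) + Yˣ (i +ᶻ 1ℤ , j -ᶻ 1ℤ , k) * Yʸ (i +ᶻ 1ℤ , j -ᶻ 1ℤ , k))
            ⟨ 1+Yˣ+YˣYʸ#0 (i +ᶻ 1ℤ , j -ᶻ 1ℤ , k) ⟩)) ×
  (  Ỹʸ (i +ᶻ 1ℤ , j , k +ᶻ 1ℤ)
     ≈ Yᶻ (i , j , k) ⁻¹⟨ Yᶻ#0 (i , j , k) ⟩
       * ((1# + Yʸ (i , j , k) + Yᶻ (i , j , k) * Yʸ (i , j , k))
          / (1# + Yˣ (i , j , k) + Yˣ (i , j , k) * Yʸ (i , j , k))
            ⟨ 1+Yˣ+YˣYʸ#0 (i , j , k) ⟩)) ×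
  (  Ỹᶻ (i +ᶻ 1ℤ , j +ᶻ 1ℤ , k)
     ≈ Yˣ (i , j , k) ⁻¹⟨ Yˣ#0 (i , j , k) ⟩
       * ((1# + Yᶻ (i , j , k) + Yˣ (i , j , k) * Yᶻ (i , j , k))
          / (1# + Yʸ (i , j , k) + Yʸ (i , j , k) * Yᶻ (i , j , k))
            ⟨ 1+Yʸ+YʸYᶻ#0 (i , j , k) ⟩)) ×
  (  Yʸ (i , j +ᶻ 1ℤ , k)
     ≈ Ỹʸ (i , j +ᶻ 1ℤ , k) * Yʸ (i , j +ᶻ 1ℤ , k -ᶻ 1ℤ) * Yᶻ (i , j +ᶻ 1ℤ , k -ᶻ 1ℤ)
       * ((1# + Yˣ (i -ᶻ 1ℤ , j +ᶻ 1ℤ , k) + Yˣ (i -ᶻ 1ℤ , j +ᶻ 1ℤ , k) * Yʸ (i -ᶻ 1ℤ , j +ᶻ 1ℤ , k))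
          / (1# + Yʸ (i , j +ᶻ 1ℤ , k -ᶻ 1ℤ) + Yʸ (i , j +ᶻ 1ℤ , k -ᶻ 1ℤ) * Yᶻ (i , j +ᶻ 1ℤ , k -ᶻ 1ℤ))
            ⟨ 1+Yʸ+YʸYᶻ#0 (i , j +ᶻ 1ℤ , k -ᶻ 1ℤ) ⟩)) ×
  (  Yᶻ (i , j , k +ᶻ 1ℤ)
     ≈ Ỹᶻ (i , j , k +ᶻ 1ℤ) * Yᶻ (i -ᶻ 1ℤ , j , k +ᶻ 1ℤ) * Yˣ (i -ᶻ 1ℤ , j , k +ᶻ 1ℤ)
       * ((1# + Yʸ (i , j -ᶻ 1ℤ , k +ᶻ 1ℤ) + Yʸ (i , j -ᶻ 1ℤ , k +ᶻ 1ℤ) * Yᶻ (i , j -ᶻ 1ℤ , k +ᶻ 1ℤ))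
          / (1# + Yᶻ (i -ᶻ 1ℤ , j , k +ᶻ 1ℤ) + Yᶻ (i -ᶻ 1ℤ , j , k +ᶻ 1ℤ) * Yˣ (i -ᶻ 1ℤ , j , k +ᶻ 1ℤ))
            ⟨ 1+Yᶻ+YᶻYˣ#0 (i -ᶻ 1ℤ , j , k +ᶻ 1ℤ) ⟩))
proposition4p12 Q isQNet W G t i j k _ =
  Ỹˣ-recurrence i j k ,
  -- The recurrences for the variables without tilde hold at every point; each is taken one step
  -- forward in its own direction.
  Yˣ-recurrence (i +ᶻ 1ℤ) j k ,
  Ỹʸ-recurrence i j k ,
  Ỹᶻ-recurrence i j k ,
  Yʸ-recurrence i (j +ᶻ 1ℤ) k ,
  Yᶻ-recurrence i j (k +ᶻ 1ℤ)
  where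
  open module ℝ-Geometry = HeytingGeometry ℝ-heytingField using (module Recurrences)
  open Recurrences Q isQNet W G
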